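{- For every integer $r\ge 1$, let $G_r(t,u,v,z)=\sum_{w} t^{\mathrm{length}(w)}u^{\mathrm{asc}(w)}v^{\mathrm{last}(w)}z^{\mathrm{zeros}(w)}$, the sum ranging over all ascent sequences $w=(x_1,\dots,x_n)$ with $x_1=\dots=x_r=0$ and $x_{r+1}=1$. Then $$G_r(t,u,v,z)=\frac{t^{r+1}z^ru}{v\delta_1-1}\left(v(v-1)+t(1-u)\big(z(v-1)-v\big)\sum_{s\ge 0}\frac{u^s(1-t)^s}{\delta_s\delta_{s+1}\prod_{i=1}^{s+1}\gamma_i}+uv^3t(1-uv)\sum_{s\ge 0}\frac{(uv)^s(1-t)^s}{\bar\delta_s\bar\delta_{s+1}\prod_{i=1}^{s+1}\bar\gamma_i}\right),$$ where the infinite sums are understood as formal power series in $u$.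
   Context: A sequence $(x_1,\dots,x_n)$ of nonnegative integers is an ascent sequence of length $n$ if $x_1=0$ and $x_i\in\{0,1,\dots,1+\mathrm{asc}(x_1,\dots,x_{i-1})\}$ for all $2\le i\le n$, where $\mathrm{asc}(y_1,\dots,y_k)=|\{1\le j<k: y_j<y_{j+1}\}|$. For an ascent sequence $w=(x_1,\dots,x_n)$: $\mathrm{length}(w)=n$, $\mathrm{asc}(w)$ is its number of ascents, $\mathrm{last}(w)=x_n$, $\mathrm{zeros}(w)$ is its number of entries equal to $0$. For $k\ge1$ set $\delta_k=u-(1-t)^k(u-1)$, $\gamma_k=u-(1-zt)(1-t)^{k-1}(u-1)$, $\bar\delta_k=uv-(1-t)^k(uv-1)$, $\bar\gamma_k=uv-(1-zt)(1-t)^{k-1}(uv-1)$, and $\delta_0=\gamma_0=\bar\delta_0=\bar\gamma_0=1$. In particular $\delta_1=1+t(u-1)$. -}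

module Defs where

open import Data.Nat as ℕ using (ℕ; zero; suc; _∸_; _≡ᵇ_; _<ᵇ_; _≤ᵇ_; _≟_)
import Data.Nat as N
open import Data.Integer as ℤ using (ℤ; +_)
open import Data.Bool using (Bool; true; false; _∧_; if_then_else_)
open import Data.List using (List; []; _∷_; [_]; _++_; take; replicate; filterᵇ; length; map; concatMap; upTo)
open import Data.List.Properties using (≡-dec)
open import Relation.Nullary using (does)
open import Relation.Binary.PropositionalEquality using (_≡_)

asc : List ℕ → ℕ
asc []           = 0
asc (x ∷ [])     = 0
asc (x ∷ y ∷ ys) = (if x <ᵇ y then 1 else 0) N.+ asc (y ∷ ys)

zeros : List ℕ → ℕ
zeros []       = 0
zeros (x ∷ xs) = (if x ≡ᵇ 0 then 1 else 0) N.+ zeros xs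

-- last entry (only used on nonempty lists)
lastℕ : List ℕ → ℕ
lastℕ []           = 0
lastℕ (x ∷ [])     = x
lastℕ (x ∷ y ∷ ys) = lastℕ (y ∷ ys)

-- 0-based entry access (entry i is x_{i+1}); only used in range
at : List ℕ → ℕ → ℕ
at []       _       = 0
at (x ∷ xs) zero    = x
at (x ∷ xs) (suc i) = at xs i

range : ℕ → ℕ → List ℕ
range from zero    = []
range from (suc k) = from ∷ range (suc from) k

allB : (ℕ → Bool) → List ℕ → Bool
allB p []       = true
allB p (x ∷ xs) = p x ∧ allB p xs

isAscent : List ℕ → Bool
isAscent []       = false
isAscent (x ∷ xs) =
  (x ≡ᵇ 0) ∧ allB (λ i → at (x ∷ xs) i ≤ᵇ suc (asc (take i (x ∷ xs)))) (range 1 (length xs))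

prefixOK : ℕ → List ℕ → Bool
prefixOK r w = does (≡-dec _≟_ (take (suc r) w) (replicate r 0 ++ [ 1 ]))

allLists : ℕ → ℕ → List (List ℕ)
allLists zero    k = [ [] ]
allLists (suc n) k = concatMap (λ x → map (x ∷_) (allLists n k)) (upTo k)

-- every ascent sequence of length n has entries ≤ n-1 < n, so it is in allLists n n

-- Formal power series in t,u,v,z over ℤ:
-- f a b c d is the coefficient of t^a u^b v^c z^d

FPS : Set
FPS = ℕ → ℕ → ℕ → ℕ → ℤ

infix 4 _≋_
_≋_ : FPS → FPS → Set
f ≋ g = ∀ a b c d → f a b c d ≡ g a b c d

sumTo : ℕ → (ℕ → ℤ) → ℤ
sumTo zero    f = f 0
sumTo (suc n) f = sumTo n f ℤ.+ f (suc n)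

mono : ℕ → ℕ → ℕ → ℕ → ℤ → FPS
mono a0 b0 c0 d0 k a b c d =
  if (a ≡ᵇ a0) ∧ (b ≡ᵇ b0) ∧ (c ≡ᵇ c0) ∧ (d ≡ᵇ d0) then k else + 0

const : ℤ → FPS
const k = mono 0 0 0 0 k

𝟙 : FPS
𝟙 = const (+ 1)

T U V Z : FPS
T = mono 1 0 0 0 (+ 1)
U = mono 0 1 0 0 (+ 1)
V = mono 0 0 1 0 (+ 1)
Z = mono 0 0 0 1 (+ 1)

infixl 6 _⊕_ _⊖_
infixl 7 _⊗_
infixr 8 _^^_

_⊕_ : FPS → FPS → FPS
(f ⊕ g) a b c d = f a b c d ℤ.+ g a b c d

⊝ : FPS → FPS
⊝ f a b c d = ℤ.- f a b c d

_⊖_ : FPS → FPS → FPS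
f ⊖ g = f ⊕ ⊝ g

_⊗_ : FPS → FPS → FPS
(f ⊗ g) a b c d =
  sumTo a λ i → sumTo b λ j → sumTo c λ k → sumTo d λ l →
    f i j k l ℤ.* g (a ∸ i) (b ∸ j) (c ∸ k) (d ∸ l)

_^^_ : FPS → ℕ → FPS
f ^^ zero  = 𝟙
f ^^ suc n = f ⊗ (f ^^ n)

-- inverse of a series with constant term 1: Σ_k (1 - f)^k
-- (the coefficient of total degree N only involves k ≤ N)
inv1 : FPS → FPS
inv1 f a b c d = sumTo (a N.+ b N.+ c N.+ d) (λ k → ((𝟙 ⊖ f) ^^ k) a b c d)

-- inverse of a series whose constant term ε is a unit (ε = ±1):
-- f⁻¹ = ε · (ε f)⁻¹
inv : FPS → FPS
inv f = const ε ⊗ inv1 (const ε ⊗ f)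
  where ε = f 0 0 0 0

-- Σ_{s ≥ 0} u^s · g s  (u-adically convergent; coefficient of u^b only
-- involves s ≤ b)
sumU : (ℕ → FPS) → FPS
sumU g a b c d = sumTo b (λ s → ((U ^^ s) ⊗ g s) a b c d)

prod1 : ℕ → (ℕ → FPS) → FPS
prod1 zero    f = 𝟙
prod1 (suc n) f = prod1 n f ⊗ f (suc n)

δ : ℕ → FPS
δ zero    = 𝟙
δ (suc k) = U ⊖ ((𝟙 ⊖ T) ^^ suc k) ⊗ (U ⊖ 𝟙)

γ : ℕ → FPS
γ zero    = 𝟙
γ (suc k) = U ⊖ (𝟙 ⊖ Z ⊗ T) ⊗ ((𝟙 ⊖ T) ^^ k) ⊗ (U ⊖ 𝟙)

δ̄ : ℕ → FPS
δ̄ zero    = 𝟙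
δ̄ (suc k) = U ⊗ V ⊖ ((𝟙 ⊖ T) ^^ suc k) ⊗ (U ⊗ V ⊖ 𝟙)

γ̄ : ℕ → FPS
γ̄ zero    = 𝟙
γ̄ (suc k) = U ⊗ V ⊖ (𝟙 ⊖ Z ⊗ T) ⊗ ((𝟙 ⊖ T) ^^ k) ⊗ (U ⊗ V ⊖ 𝟙)

G : ℕ → FPS
G r n b c d = + length (filterᵇ (λ w → isAscent w ∧ prefixOK r w ∧ (asc w ≡ᵇ b)
                                        ∧ (lastℕ w ≡ᵇ c) ∧ (zeros w ≡ᵇ d))
                                (allLists n n))

{-# OPTIONS --safe #-}
module Submission where

-- Let Ĝ(α, β) be the sum over the ascent sequences extending 0ʳ1 of
-- t^(number of appended entries) α^asc β^last z^zeros. Appending one more entry gives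
--   (β (1 + t (α - 1)) - 1) Ĝ(α, β)
--     = α β z^r (β - 1) + t ((z (β - 1) - β) Ĝ(α, 1) + α β² Ĝ(α β, 1)).
-- Each power of t carries a finite sum, so α and β may be arbitrary power series, and
-- α = x / δ_k, β = δ_k / δ_{k+1} (with δ_k taken at u = x) annihilates the left-hand side.
-- What remains expresses Ĝ(x / δ_k, 1) through Ĝ(x / δ_{k+1}, 1); iterating it sums
-- Ĝ(x, 1), which is needed at x = u and at x = u v.

open import Algebra.Bundles using (CommutativeRing)
import Algebra.Construct.Pointwise as Pointwise
import Algebra.Properties.CommutativeSemigroup as CommutativeSemigroupProperties
import Algebra.Properties.CommutativeSemiring.Exp as Exp
import Algebra.Properties.Ring as RingProperties
import Algebra.Properties.Semiring.Mult.TCOptimised as Mult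
import Algebra.Solver.Ring as RingSolver
import Algebra.Solver.Ring.AlmostCommutativeRing as ACR
open import Data.Bool using (Bool; true; false; if_then_else_; _∧_)
open import Data.Bool.Properties using (∧-zeroʳ; ∧-assoc; T-≡)
open import Data.Integer as ℤ using (ℤ; +_; -[1+_])
import Data.Integer.Properties as ℤ
open import Data.List using (List; []; _∷_; [_]; _++_; take; replicate; filterᵇ; length; map;
  concatMap; applyUpTo)
open import Data.List.Properties using (++-assoc; length-++)
open import Data.Maybe using (Maybe; just; nothing)
open import Data.Nat as ℕ using (ℕ; zero; suc; _∸_; _<ᵇ_; _≡ᵇ_; _≤ᵇ_; _≤_; z≤n; s≤s)
import Data.Nat.Properties as ℕ
open import Data.Product using (_,_)
open import Defs
open import Function using (_∘_; id)
open import Function.Bundles using (Equivalence)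
open import Level using (0ℓ)
import Relation.Binary.PropositionalEquality as ≡
open ≡ using (_≡_)
import Relation.Binary.Reasoning.Setoid as SetoidReasoning
open import Relation.Nullary using (yes; no; contradiction)

-- Since δ_{k+1} = δ_k + t (x - δ_k), the chosen point satisfies β (1 + t (α - 1)) = 1, and α β = x
-- / δ_{k+1} is the next α, so the substitutions form a chain. There β - 1 = t (δ_k - x) / δ_{k+1}:
-- every surviving term is divisible by t, and cancelling t leaves Ĝ(x / δ_k, 1) with coefficient
-- -γ_{k+1} / δ_{k+1}, because γ_{k+1} = δ_k - z t (δ_k - x). This is the origin of the products of
-- the γ_i. Each round also contributes a factor x, which is u or u v, so the remainder after n
-- rounds is divisible by u^n. Three filtrations of one ring are therefore at work: degree in t
-- defines Ĝ and justifies the substitutions, degree in u makes the iteration converge, and total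
-- degree yields the inverses of series with constant term ±1. In each case an equation of series is
-- obtained from the uniqueness of infinite sums.

module ℕ+ = CommutativeSemigroupProperties ℕ.+-commutativeSemigroup

-- Rings of formal power series

module PowerSeries (R : CommutativeRing 0ℓ 0ℓ) where

  open CommutativeRing R
  open SetoidReasoning setoid
  open import Algebra.Properties.CommutativeSemigroup +-commutativeSemigroup
    using (interchange; x∙yz≈y∙xz)

  -- conv h n is the sum of h i j over i + j ≡ n.
  conv : (ℕ → ℕ → Carrier) → ℕ → Carrier
  conv h zero    = h 0 0
  conv h (suc n) = h 0 (suc n) + conv (λ i → h (suc i)) n

  conv-cong : ∀ {g h} → (∀ i j → g i j ≈ h i j) → ∀ n → conv g n ≈ conv h n
  conv-cong g≈h zero    = g≈h 0 0
  conv-cong g≈h (suc n) =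
    +-cong (g≈h 0 (suc n)) (conv-cong (λ i → g≈h (suc i)) n)

  conv-+ : ∀ g h n → conv (λ i j → g i j + h i j) n ≈ conv g n + conv h n
  conv-+ g h zero    = refl
  conv-+ g h (suc n) =
    trans (+-congˡ (conv-+ (λ i → g (suc i)) (λ i → h (suc i)) n))
          (interchange _ _ _ _)

  conv-*ˡ : ∀ x h n → conv (λ i j → x * h i j) n ≈ x * conv h n
  conv-*ˡ x h zero    = refl
  conv-*ˡ x h (suc n) =
    trans (+-congˡ (conv-*ˡ x (λ i → h (suc i)) n)) (sym (distribˡ x _ _))

  conv-0 : ∀ n → conv (λ _ _ → 0#) n ≈ 0#
  conv-0 zero    = refl
  conv-0 (suc n) = trans (+-identityˡ _) (conv-0 n)

  conv-last : ∀ h n → conv h (suc n) ≈ h (suc n) 0 + conv (λ i j → h i (suc j)) n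
  conv-last h zero    = +-comm _ _
  conv-last h (suc n) =
    trans (+-congˡ (conv-last (λ i → h (suc i)) n)) (x∙yz≈y∙xz _ _ _)

  conv-flip : ∀ h n → conv h n ≈ conv (λ i j → h j i) n
  conv-flip h zero    = refl
  conv-flip h (suc n) =
    trans (+-congˡ (conv-flip (λ i → h (suc i)) n))
          (sym (conv-last (λ i j → h j i) n))

  -- Both sides collect `h i j k` over i + j + k = n. Leaving `h` arbitrary, rather than a product
  -- of three series, lets the induction shift its first index.
  conv-assoc : ∀ (h : ℕ → ℕ → ℕ → Carrier) n →
    conv (λ m k → conv (λ i j → h i j k) m) n ≈ conv (λ i → conv (h i)) n
  conv-assoc h zero    = refl
  conv-assoc h (suc n) = begin
    h 0 0 (suc n) +
      conv (λ m k → h 0 (suc m) k + conv (λ i j → h (suc i) j k) m) n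
      ≈⟨ +-congˡ (conv-+ (λ m → h 0 (suc m)) _ n) ⟩
    h 0 0 (suc n) + (conv (λ m → h 0 (suc m)) n +
      conv (λ m k → conv (λ i j → h (suc i) j k) m) n)
      ≈⟨ +-assoc _ _ _ ⟨
    conv (h 0) (suc n) + conv (λ m k → conv (λ i j → h (suc i) j k) m) n
      ≈⟨ +-congˡ (conv-assoc (λ i → h (suc i)) n) ⟩
    conv (h 0) (suc n) + conv (λ i → conv (h (suc i))) n ∎

  Series : Set
  Series = ℕ → Carrier

  module Additive = CommutativeRing (Pointwise.commutativeRing ℕ R)
  open Additive public using () renaming (_≈_ to _≈ˢ_)

  infixl 7 _*ˢ_
  _*ˢ_ : Series → Series → Series
  (f *ˢ g) n = conv (λ i j → f i * g j) n

  C : Carrier → Series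
  C x zero    = x
  C x (suc n) = 0#

  X : Series
  X zero          = 0#
  X (suc zero)    = 1#
  X (suc (suc n)) = 0#

  C-*ˢ : ∀ x f n → (C x *ˢ f) n ≈ x * f n
  C-*ˢ x f zero    = refl
  C-*ˢ x f (suc n) =
    trans (+-congˡ (trans (conv-cong (λ _ _ → zeroˡ _) n) (conv-0 n)))
          (+-identityʳ _)

  X-*ˢ-zero : ∀ f → (X *ˢ f) 0 ≈ 0#
  X-*ˢ-zero f = zeroˡ _

  X-*ˢ-suc : ∀ f n → (X *ˢ f) (suc n) ≈ f n
  X-*ˢ-suc f zero    = trans (+-cong (zeroˡ _) (*-identityˡ _)) (+-identityˡ _)
  X-*ˢ-suc f (suc n) = begin
    0# * f (suc (suc n)) + (1# * f (suc n) + conv (λ i j → 0# * f j) n)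
      ≈⟨ +-cong (zeroˡ _) (+-cong (*-identityˡ _)
           (trans (conv-cong (λ _ _ → zeroˡ _) n) (conv-0 n))) ⟩
    0# + (f (suc n) + 0#)
      ≈⟨ trans (+-identityˡ _) (+-identityʳ _) ⟩
    f (suc n) ∎

  *ˢ-cong : ∀ {f f′ g g′} → f ≈ˢ f′ → g ≈ˢ g′ → (f *ˢ g) ≈ˢ (f′ *ˢ g′)
  *ˢ-cong f≈ g≈ = conv-cong (λ i j → *-cong (f≈ i) (g≈ j))

  *ˢ-comm : ∀ f g → (f *ˢ g) ≈ˢ (g *ˢ f)
  *ˢ-comm f g n =
    trans (conv-flip (λ i j → f i * g j) n) (conv-cong (λ _ _ → *-comm _ _) n)

  *ˢ-assoc : ∀ f g h → ((f *ˢ g) *ˢ h) ≈ˢ (f *ˢ (g *ˢ h))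
  *ˢ-assoc f g h n = begin
    conv (λ m k → conv (λ i j → f i * g j) m * h k) n
      ≈⟨ conv-cong (λ m k → trans (*-comm _ _) (trans
           (sym (conv-*ˡ (h k) (λ i j → f i * g j) m))
           (conv-cong (λ i j → trans (*-comm _ _) (*-assoc _ _ _)) m))) n ⟩
    conv (λ m k → conv (λ i j → f i * (g j * h k)) m) n
      ≈⟨ conv-assoc (λ i j k → f i * (g j * h k)) n ⟩
    conv (λ i m → conv (λ j k → f i * (g j * h k)) m) n
      ≈⟨ conv-cong (λ i → conv-*ˡ (f i) (λ j k → g j * h k)) n ⟩
    conv (λ i m → f i * conv (λ j k → g j * h k) m) n ∎

  *ˢ-distribˡ : ∀ f g h → (f *ˢ (λ n → g n + h n)) ≈ˢ (λ n → (f *ˢ g) n + (f *ˢ h) n)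
  *ˢ-distribˡ f g h n =
    trans (conv-cong (λ _ _ → distribˡ _ _ _) n) (conv-+ _ _ n)

  *ˢ-identityˡ : ∀ f → (C 1# *ˢ f) ≈ˢ f
  *ˢ-identityˡ f n = trans (C-*ˢ 1# f n) (*-identityˡ _)

  commutativeRing : CommutativeRing 0ℓ 0ℓ
  commutativeRing = record
    { Carrier = Series
    ; _≈_     = _≈ˢ_
    ; _+_     = Additive._+_
    ; _*_     = _*ˢ_
    ; -_      = Additive.-_
    ; 0#      = Additive.0#
    ; 1#      = C 1#
    ; isCommutativeRing = record
      { isRing = record
        { +-isAbelianGroup = Additive.+-isAbelianGroup
        ; *-cong           = *ˢ-cong
        ; *-assoc          = *ˢ-assoc
        ; *-identity       = *ˢ-identityˡ ,
            λ f → Additive.trans (*ˢ-comm f (C 1#)) (*ˢ-identityˡ f)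
        ; distrib          = *ˢ-distribˡ ,
            λ f g h → Additive.trans (*ˢ-comm (λ n → g n + h n) f) (Additive.trans
              (*ˢ-distribˡ f g h) λ n → +-cong (*ˢ-comm f g n) (*ˢ-comm f h n))
        }
      ; *-comm = *ˢ-comm
      }
    }

-- The variables are adjoined innermost first: z, v, u, t. Carrier and equality of the fourth ring
-- then agree with `FPS` and `_≋_` by computation, the outermost index being the power of t.
module PS₁ = PowerSeries ℤ.+-*-commutativeRing
module PS₂ = PowerSeries PS₁.commutativeRing
module PS₃ = PowerSeries PS₂.commutativeRing
module PS₄ = PowerSeries PS₃.commutativeRing

private
  module P₁ = CommutativeRing PS₁.commutativeRing
  module P₂ = CommutativeRing PS₂.commutativeRing
  module P₃ = CommutativeRing PS₃.commutativeRing
  module P₄ = CommutativeRing PS₄.commutativeRing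

sumTo-front : ∀ n (f : ℕ → ℤ) → sumTo (suc n) f ≡ f 0 ℤ.+ sumTo n (λ i → f (suc i))
sumTo-front zero    f = ≡.refl
sumTo-front (suc n) f =
  ≡.trans (≡.cong (λ s → s ℤ.+ f (suc (suc n))) (sumTo-front n f)) (ℤ.+-assoc (f 0) _ _)

sumTo≡conv : ∀ n (h : ℕ → ℕ → ℤ) → sumTo n (λ i → h i (n ∸ i)) ≡ PS₁.conv h n
sumTo≡conv zero    h = ≡.refl
sumTo≡conv (suc n) h = ≡.trans (sumTo-front n (λ i → h i (suc n ∸ i)))
  (≡.cong (λ s → h 0 (suc n) ℤ.+ s) (sumTo≡conv n (λ i → h (suc i))))

module _ (R : CommutativeRing 0ℓ 0ℓ) where
  private
    module R = CommutativeRing R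
    module S = PowerSeries R
    module SS = PowerSeries S.commutativeRing

  -- Series are added coefficientwise, so taking a coefficient passes through `conv`. Applied layer
  -- by layer, this turns an iterated product into a nested sum of integers.
  conv-eval : ∀ (h : ℕ → ℕ → ℕ → R.Carrier) n b →
              SS.conv h n b R.≈ S.conv (λ i j → h i j b) n
  conv-eval h zero    b = R.refl
  conv-eval h (suc n) b = R.+-congˡ (conv-eval (λ i → h (suc i)) n b)

-- Carries the ring laws over to `_⊗_`: `FPS` shares its additive structure with the iterated ring,
-- so only the product and the unit have to be compared.
⊗≋* : ∀ f g → (f ⊗ g) ≋ (f P₄.* g)
⊗≋* f g a b c d = begin
  sumTo a (λ i → sumTo b λ j → sumTo c λ k → sumTo d λ l →
    f i j k l ℤ.* g (a ∸ i) (b ∸ j) (c ∸ k) (d ∸ l))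
    ≡⟨ sumTo≡conv a (λ i i′ → sumTo b λ j → sumTo c λ k → sumTo d λ l →
         f i j k l ℤ.* g i′ (b ∸ j) (c ∸ k) (d ∸ l)) ⟩
  PS₁.conv (λ i i′ → sumTo b λ j → sumTo c λ k → sumTo d λ l →
    f i j k l ℤ.* g i′ (b ∸ j) (c ∸ k) (d ∸ l)) a
    ≡⟨ PS₁.conv-cong (λ i i′ → eq₃ (f i) (g i′)) a ⟩
  PS₁.conv (λ i i′ → (f i P₃.* g i′) b c d) a
    ≡⟨ conv-eval ℤ.+-*-commutativeRing (λ i i′ e → (f i P₃.* g i′) b c e) a d ⟨
  PS₂.conv (λ i i′ → (f i P₃.* g i′) b c) a d
    ≡⟨ conv-eval PS₁.commutativeRing (λ i i′ e → (f i P₃.* g i′) b e) a c d ⟨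
  PS₃.conv (λ i i′ → (f i P₃.* g i′) b) a c d
    ≡⟨ conv-eval PS₂.commutativeRing (λ i i′ → f i P₃.* g i′) a b c d ⟨
  (f P₄.* g) a b c d ∎
  where
  open ≡.≡-Reasoning
  eq₁ : ∀ (f g : ℕ → ℤ) → sumTo d (λ l → f l ℤ.* g (d ∸ l)) ≡ (f P₁.* g) d
  eq₁ f g = sumTo≡conv d (λ l l′ → f l ℤ.* g l′)
  eq₂ : ∀ (f g : ℕ → ℕ → ℤ) → sumTo c (λ k → sumTo d λ l →
    f k l ℤ.* g (c ∸ k) (d ∸ l)) ≡ (f P₂.* g) c d
  eq₂ f g = ≡.trans (sumTo≡conv c (λ k k′ → sumTo d λ l → f k l ℤ.* g k′ (d ∸ l)))
    (≡.trans (PS₁.conv-cong (λ k k′ → eq₁ (f k) (g k′)) c)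
      (≡.sym (conv-eval ℤ.+-*-commutativeRing (λ k k′ → f k P₁.* g k′) c d)))
  eq₃ : ∀ (f g : ℕ → ℕ → ℕ → ℤ) → sumTo b (λ j → sumTo c λ k → sumTo d λ l →
    f j k l ℤ.* g (b ∸ j) (c ∸ k) (d ∸ l)) ≡ (f P₃.* g) b c d
  eq₃ f g = ≡.trans (sumTo≡conv b (λ j j′ → sumTo c λ k → sumTo d λ l →
      f j k l ℤ.* g j′ (c ∸ k) (d ∸ l)))
    (≡.trans (PS₁.conv-cong (λ j j′ → eq₂ (f j) (g j′)) b)
      (≡.trans (≡.sym (conv-eval ℤ.+-*-commutativeRing (λ j j′ e → (f j P₂.* g j′) c e) b d))
        (≡.sym (conv-eval PS₁.commutativeRing (λ j j′ → f j P₂.* g j′) b c d))))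

𝟙≋1# : 𝟙 ≋ P₄.1#
𝟙≋1# zero    zero    zero    zero    = ≡.refl
𝟙≋1# zero    zero    zero    (suc d) = ≡.refl
𝟙≋1# zero    zero    (suc c) d       = ≡.refl
𝟙≋1# zero    (suc b) c       d       = ≡.refl
𝟙≋1# (suc a) b       c       d       = ≡.refl

FPS-commutativeRing : CommutativeRing 0ℓ 0ℓ
FPS-commutativeRing = record
  { Carrier = FPS
  ; _≈_     = _≋_
  ; _+_     = _⊕_
  ; _*_     = _⊗_
  ; -_      = ⊝
  ; 0#      = λ _ _ _ _ → + 0
  ; 1#      = 𝟙
  ; isCommutativeRing = record
    { isRing = record
      { +-isAbelianGroup = P₄.+-isAbelianGroup
      ; *-cong           = λ {f} {f′} {g} {g′} → cong′ {f} {f′} {g} {g′}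
      ; *-assoc          = λ f g h → begin
          (f ⊗ g) ⊗ h        ≈⟨ ⊗≋* (f ⊗ g) h ⟩
          (f ⊗ g) P₄.* h     ≈⟨ P₄.*-congʳ {h} (⊗≋* f g) ⟩
          (f P₄.* g) P₄.* h  ≈⟨ P₄.*-assoc f g h ⟩
          f P₄.* (g P₄.* h)  ≈⟨ P₄.*-congˡ {f} (⊗≋* g h) ⟨
          f P₄.* (g ⊗ h)     ≈⟨ ⊗≋* f (g ⊗ h) ⟨
          f ⊗ (g ⊗ h)        ∎
      ; *-identity       = identityˡ , λ f → P₄.trans (comm f 𝟙) (identityˡ f)
      ; distrib          = distribˡ , λ f g h → P₄.trans (comm (g ⊕ h) f)
          (P₄.trans (distribˡ f g h) (P₄.+-cong (comm f g) (comm f h)))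
      }
    ; *-comm = comm
    }
  }
  where
  open SetoidReasoning P₄.setoid
  cong′ : ∀ {f f′ g g′} → f ≋ f′ → g ≋ g′ → f ⊗ g ≋ f′ ⊗ g′
  cong′ {f} {f′} {g} {g′} p q =
    P₄.trans (⊗≋* f g) (P₄.trans (P₄.*-cong p q) (P₄.sym (⊗≋* f′ g′)))
  comm : ∀ f g → f ⊗ g ≋ g ⊗ f
  comm f g = P₄.trans (⊗≋* f g) (P₄.trans (P₄.*-comm f g) (P₄.sym (⊗≋* g f)))
  identityˡ : ∀ f → 𝟙 ⊗ f ≋ f
  identityˡ f = P₄.trans (⊗≋* 𝟙 f) (P₄.trans (P₄.*-congʳ {f} 𝟙≋1#) (P₄.*-identityˡ f))
  distribˡ : ∀ f g h → f ⊗ (g ⊕ h) ≋ f ⊗ g ⊕ f ⊗ h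
  distribˡ f g h = begin
    f ⊗ (g ⊕ h)          ≈⟨ ⊗≋* f (g ⊕ h) ⟩
    f P₄.* (g ⊕ h)       ≈⟨ P₄.distribˡ f g h ⟩
    f P₄.* g ⊕ f P₄.* h  ≈⟨ P₄.+-cong (⊗≋* f g) (⊗≋* f h) ⟨
    f ⊗ g ⊕ f ⊗ h        ∎

-- Filtered rings and formal sums

-- Equality of power series cannot be decided, so the solver takes its coefficients in ℤ, mapped
-- into `R` by `⟦_⟧`. Comparing integers is what lets it recognise terms that cancel.
module IntegerSolver (R : CommutativeRing 0ℓ 0ℓ) where

  open CommutativeRing R
  open RingProperties ring
  open import Algebra.Properties.AbelianGroup +-abelianGroup
    using (⁻¹-∙-comm; ⁻¹-involutive; ε⁻¹≈ε)
  open CommutativeSemigroupProperties +-commutativeSemigroup using (interchange)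
  open SetoidReasoning setoid
  private module × = Mult semiring

  ⟦_⟧ : ℤ → Carrier
  ⟦ + n ⟧      = n ×.× 1#
  ⟦ -[1+ n ] ⟧ = - (suc n ×.× 1#)

  ⟦⟧-neg : ∀ i → ⟦ ℤ.- i ⟧ ≈ - ⟦ i ⟧
  ⟦⟧-neg (+ zero)   = sym ε⁻¹≈ε
  ⟦⟧-neg (+ suc n)  = refl
  ⟦⟧-neg -[1+ n ]   = sym (⁻¹-involutive _)

  private
    cancel-suc : ∀ m n → m ×.× 1# - n ×.× 1# ≈ suc m ×.× 1# - suc n ×.× 1#
    cancel-suc m n = sym (begin
      suc m ×.× 1# - suc n ×.× 1#
        ≈⟨ +-cong (×.1+× m 1#) (-‿cong (×.1+× n 1#)) ⟩
      (1# + m ×.× 1#) - (1# + n ×.× 1#)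
        ≈⟨ +-congˡ (⁻¹-∙-comm _ _) ⟨
      (1# + m ×.× 1#) + (- 1# + - (n ×.× 1#))
        ≈⟨ interchange _ _ _ _ ⟩
      (1# - 1#) + (m ×.× 1# - n ×.× 1#)
        ≈⟨ trans (+-congʳ (-‿inverseʳ 1#)) (+-identityˡ _) ⟩
      m ×.× 1# - n ×.× 1# ∎)

  ⟦⟧-⊖ : ∀ m n → ⟦ m ℤ.⊖ n ⟧ ≈ m ×.× 1# - n ×.× 1#
  ⟦⟧-⊖ m       zero    = trans (sym (+-identityʳ _)) (+-congˡ (sym ε⁻¹≈ε))
  ⟦⟧-⊖ zero    (suc n) = sym (+-identityˡ _)
  ⟦⟧-⊖ (suc m) (suc n) = begin
    ⟦ suc m ℤ.⊖ suc n ⟧          ≡⟨ ≡.cong ⟦_⟧ (ℤ.[1+m]⊖[1+n]≡m⊖n m n) ⟩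
    ⟦ m ℤ.⊖ n ⟧                  ≈⟨ ⟦⟧-⊖ m n ⟩
    m ×.× 1# - n ×.× 1#          ≈⟨ cancel-suc m n ⟩
    suc m ×.× 1# - suc n ×.× 1#  ∎

  ⟦⟧-+ : ∀ i j → ⟦ i ℤ.+ j ⟧ ≈ ⟦ i ⟧ + ⟦ j ⟧
  ⟦⟧-+ (+ m)    (+ n)    = ×.×-homo-+ 1# m n
  ⟦⟧-+ (+ m)    -[1+ n ] = ⟦⟧-⊖ m (suc n)
  ⟦⟧-+ -[1+ m ] (+ n)    = trans (⟦⟧-⊖ n (suc m)) (+-comm _ _)
  ⟦⟧-+ -[1+ m ] -[1+ n ] = begin
    - (suc (suc (m ℕ.+ n)) ×.× 1#)   ≡⟨ ≡.cong (λ k → - (suc k ×.× 1#)) (ℕ.+-suc m n) ⟨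
    - ((suc m ℕ.+ suc n) ×.× 1#)     ≈⟨ -‿cong (×.×-homo-+ 1# (suc m) (suc n)) ⟩
    - (suc m ×.× 1# + suc n ×.× 1#)  ≈⟨ ⁻¹-∙-comm _ _ ⟨
    - (suc m ×.× 1#) - (suc n ×.× 1#) ∎

  ⟦⟧-*-pos : ∀ m j → ⟦ + m ℤ.* j ⟧ ≈ ⟦ + m ⟧ * ⟦ j ⟧
  ⟦⟧-*-pos m (+ n) = begin
    ⟦ + m ℤ.* + n ⟧  ≡⟨ ≡.cong ⟦_⟧ (ℤ.pos-* m n) ⟨
    ⟦ + (m ℕ.* n) ⟧  ≈⟨ ×.×1-homo-* m n ⟩
    ⟦ + m ⟧ * ⟦ + n ⟧ ∎
  ⟦⟧-*-pos m -[1+ n ] = begin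
    ⟦ + m ℤ.* -[1+ n ] ⟧           ≡⟨ ≡.cong ⟦_⟧ (ℤ.neg-distribʳ-* (+ m) (+ suc n)) ⟨
    ⟦ ℤ.- (+ m ℤ.* + suc n) ⟧      ≈⟨ ⟦⟧-neg (+ m ℤ.* + suc n) ⟩
    - ⟦ + m ℤ.* + suc n ⟧          ≈⟨ -‿cong (⟦⟧-*-pos m (+ suc n)) ⟩
    - (⟦ + m ⟧ * ⟦ + suc n ⟧)      ≈⟨ -‿distribʳ-* _ _ ⟩
    ⟦ + m ⟧ * ⟦ -[1+ n ] ⟧         ∎

  ⟦⟧-* : ∀ i j → ⟦ i ℤ.* j ⟧ ≈ ⟦ i ⟧ * ⟦ j ⟧
  ⟦⟧-* (+ m)    j = ⟦⟧-*-pos m j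
  ⟦⟧-* -[1+ m ] j = begin
    ⟦ -[1+ m ] ℤ.* j ⟧             ≡⟨ ≡.cong ⟦_⟧ (ℤ.neg-distribˡ-* (+ suc m) j) ⟨
    ⟦ ℤ.- (+ suc m ℤ.* j) ⟧        ≈⟨ ⟦⟧-neg (+ suc m ℤ.* j) ⟩
    - ⟦ + suc m ℤ.* j ⟧            ≈⟨ -‿cong (⟦⟧-*-pos (suc m) j) ⟩
    - (⟦ + suc m ⟧ * ⟦ j ⟧)        ≈⟨ -‿distribˡ-* _ _ ⟩
    ⟦ -[1+ m ] ⟧ * ⟦ j ⟧           ∎

  private
    almostCommutativeRing : ACR.AlmostCommutativeRing 0ℓ 0ℓ
    almostCommutativeRing = ACR.fromCommutativeRing R

    morphism : CommutativeRing.rawRing ℤ.+-*-commutativeRing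
               ACR.-Raw-AlmostCommutative⟶ almostCommutativeRing
    morphism = record
      { ⟦_⟧    = ⟦_⟧
      ; +-homo = ⟦⟧-+
      ; *-homo = ⟦⟧-*
      ; -‿homo = ⟦⟧-neg
      ; 0-homo = refl
      ; 1-homo = refl
      }

    coeff≟ : ∀ i j → Maybe (⟦ i ⟧ ≈ ⟦ j ⟧)
    coeff≟ i j with i ℤ.≟ j
    ... | yes i≡j = just (reflexive (≡.cong ⟦_⟧ i≡j))
    ... | no  _   = nothing

  open RingSolver (CommutativeRing.rawRing ℤ.+-*-commutativeRing)
    almostCommutativeRing morphism coeff≟ public
    using (solve; con; _:=_; _:+_; _:-_; _:*_; :-_)

module Sums (R : CommutativeRing 0ℓ 0ℓ) where

  open CommutativeRing R
  open CommutativeSemigroupProperties +-commutativeSemigroup using (interchange)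

  Σ< : ℕ → (ℕ → Carrier) → Carrier
  Σ< zero    f = 0#
  Σ< (suc n) f = f 0 + Σ< n (λ i → f (suc i))

  Σ<-cong : ∀ n {f g} → (∀ i → i ℕ.< n → f i ≈ g i) → Σ< n f ≈ Σ< n g
  Σ<-cong zero    f≈g = refl
  Σ<-cong (suc n) f≈g = +-cong (f≈g 0 (s≤s z≤n)) (Σ<-cong n (λ i i<n → f≈g (suc i) (s≤s i<n)))

  Σ<-+ : ∀ n f g → Σ< n (λ i → f i + g i) ≈ Σ< n f + Σ< n g
  Σ<-+ zero    f g = sym (+-identityˡ 0#)
  Σ<-+ (suc n) f g = trans (+-congˡ (Σ<-+ n _ _)) (interchange _ _ _ _)

  Σ<-*ˡ : ∀ n x f → Σ< n (λ i → x * f i) ≈ x * Σ< n f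
  Σ<-*ˡ zero    x f = sym (zeroʳ x)
  Σ<-*ˡ (suc n) x f = trans (+-congˡ (Σ<-*ˡ n x _)) (sym (distribˡ x _ _))

  Σ<-++ : ∀ m n f → Σ< (m ℕ.+ n) f ≈ Σ< m f + Σ< n (λ i → f (m ℕ.+ i))
  Σ<-++ zero    n f = sym (+-identityˡ _)
  Σ<-++ (suc m) n f =
    trans (+-congˡ (Σ<-++ m n (λ i → f (suc i)))) (sym (+-assoc _ _ _))

  Σ<-last : ∀ n f → Σ< (suc n) f ≈ Σ< n f + f n
  Σ<-last zero    f = +-comm _ _
  Σ<-last (suc n) f =
    trans (+-congˡ (Σ<-last n (λ i → f (suc i)))) (sym (+-assoc _ _ _))

  Σ<-zero : ∀ n {f} → (∀ i → i ℕ.< n → f i ≈ 0#) → Σ< n f ≈ 0#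
  Σ<-zero zero    f≈0 = refl
  Σ<-zero (suc n) f≈0 = trans
    (+-cong (f≈0 0 (s≤s z≤n)) (Σ<-zero n (λ i i<n → f≈0 (suc i) (s≤s i<n))))
    (+-identityˡ 0#)

-- `ord n` stands for membership in the nth of a family of ideals with zero intersection. This is
-- enough for infinite sums to be unique; that they exist is shown for concrete series in
-- `limit-sum`.
record Filtration (R : CommutativeRing 0ℓ 0ℓ) : Set₁ where
  open CommutativeRing R
  field
    ord       : ℕ → Carrier → Set
    ord-cong  : ∀ {n x y} → x ≈ y → ord n x → ord n y
    ord-+     : ∀ {n x y} → ord n x → ord n y → ord n (x + y)
    ord-*     : ∀ {n} x {y} → ord n y → ord n (x * y)
    ord-0     : ∀ {x} → ord 0 x
    separated : ∀ {x} → (∀ n → ord n x) → x ≈ 0#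

module FormalSums {R : CommutativeRing 0ℓ 0ℓ} (F : Filtration R) where

  open CommutativeRing R
  open Filtration F
  open Sums R
  open IntegerSolver R
  open import Algebra.Properties.Group +-group using (x∙y⁻¹≈ε⇒x≈y)

  -- Convergence at a fixed rate, so that sums can be added, scaled and compared without moduli of
  -- convergence.
  HasSum : (ℕ → Carrier) → Carrier → Set
  HasSum h s = ∀ n → ord n (s - Σ< n h)

  HasSum-unique : ∀ {h s s′} → HasSum h s → HasSum h s′ → s ≈ s′
  HasSum-unique {h} {s} {s′} p q = x∙y⁻¹≈ε⇒x≈y s s′ (separated λ n →
    ord-cong (solve 3 (λ s s′ S → (s :- S) :+ :- con (+ 1) :* (s′ :- S) := s :- s′) refl
                    s s′ (Σ< n h))
             (ord-+ (p n) (ord-* (- 1#) (q n))))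

  HasSum-cong : ∀ {g h s} → (∀ n → g n ≈ h n) → HasSum g s → HasSum h s
  HasSum-cong g≈h p n =
    ord-cong (+-congˡ (-‿cong (Σ<-cong n (λ i _ → g≈h i)))) (p n)

  HasSum-+ : ∀ {g h s s′} → HasSum g s → HasSum h s′ →
             HasSum (λ n → g n + h n) (s + s′)
  HasSum-+ {g} {h} {s} {s′} p q n = ord-cong
    (trans (solve 4 (λ s s′ S S′ → (s :- S) :+ (s′ :- S′) := s :+ s′ :- (S :+ S′)) refl
                  s s′ (Σ< n g) (Σ< n h))
           (+-congˡ (-‿cong (sym (Σ<-+ n g h)))))
    (ord-+ (p n) (q n))

  HasSum-* : ∀ x {h s} → HasSum h s → HasSum (λ n → x * h n) (x * s)
  HasSum-* x {h} {s} p n = ord-cong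
    (trans (solve 3 (λ x s S → x :* (s :- S) := x :* s :- x :* S) refl x s (Σ< n h))
           (+-congˡ (-‿cong (sym (Σ<-*ˡ n x h)))))
    (ord-* x (p n))

  -- Prepending the term `g 0` costs one order of accuracy, and the factor `t` gains it back.
  HasSum-shift : ∀ {t} → (∀ {n y} → ord n y → ord (suc n) (t * y)) →
    ∀ {g h s} → HasSum h s → (∀ n → g (suc n) ≈ t * h n) → HasSum g (g 0 + t * s)
  HasSum-shift raise p g≈ zero = ord-0
  HasSum-shift {t} raise {g} {h} {s} p g≈ (suc n) = ord-cong
    (trans (solve 4 (λ t s S x → t :* (s :- S) := x :+ t :* s :- (x :+ t :* S)) refl
                  t s (Σ< n h) (g 0))
           (+-congˡ (-‿cong (+-congˡ (trans (sym (Σ<-*ˡ n t h))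
             (Σ<-cong n (λ i _ → sym (g≈ i))))))))
    (raise (p n))

-- Extensions of ascent sequences

ascent : ℕ → ℕ → ℕ
ascent l x = if l <ᵇ x then 1 else 0

isZero : ℕ → ℕ
isZero x = if x ≡ᵇ 0 then 1 else 0

ascent-≤ : ∀ {l x} → x ≤ l → ascent l x ≡ 0
ascent-≤ z≤n       = ≡.refl
ascent-≤ (s≤s x≤l) = ascent-≤ x≤l

ascent-> : ∀ {l x} → l ℕ.< x → ascent l x ≡ 1
ascent-> {zero}  (s≤s z≤n) = ≡.refl
ascent-> {suc l} (s≤s l<x) = ascent-> l<x

-- Appending an entry preserves the invariant that the last entry is at most the number of ascents:
-- an entry above `l` creates an ascent, any other is at most `l`.
≤-ascent : ∀ {a l} x → l ≤ a → x ≤ suc a → x ≤ ascent l x ℕ.+ a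
≤-ascent {a} {l} x l≤a x≤1+a with x ℕ.≤? l
... | yes x≤l = ≡.subst (λ e → x ≤ e ℕ.+ a) (≡.sym (ascent-≤ x≤l)) (ℕ.≤-trans x≤l l≤a)

... | no  x≰l = ≡.subst (λ e → x ≤ e ℕ.+ a) (≡.sym (ascent-> (ℕ.≰⇒> x≰l))) x≤1+a

-- A state (a , l , q) records the number of ascents, the last entry and the
-- number of zeros of an ascent sequence; extend m φ sums φ over the states of
-- all its extensions by m further entries.
module Extensions (R : CommutativeRing 0ℓ 0ℓ) where

  open CommutativeRing R
  open Sums R
  open IntegerSolver R
  open Exp commutativeSemiring using (_^_; ^-homo-*; ^-distrib-*)
  open SetoidReasoning setoid

  Statistic : Set
  Statistic = ℕ → ℕ → ℕ → Carrier

  append : Statistic → ℕ → ℕ → ℕ → ℕ → Carrier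
  append φ a l q x = φ (ascent l x ℕ.+ a) x (isZero x ℕ.+ q)

  extend₁ : Statistic → Statistic
  extend₁ φ a l q = Σ< (suc (suc a)) (append φ a l q)

  extend : ℕ → Statistic → Statistic
  extend zero    φ = φ
  extend (suc m) φ = extend₁ (extend m φ)

  infix 4 _≈ᵛ_
  -- Agreement is asked only on states with `l ≤ a`, as `extend₁-monomial` needs this to split the
  -- range of the appended entry at `l`; by `≤-ascent` such states are closed under extension.
  _≈ᵛ_ : Statistic → Statistic → Set
  φ ≈ᵛ ψ = ∀ {a l} q → l ≤ a → φ a l q ≈ ψ a l q

  extend₁-cong : ∀ {φ ψ} → φ ≈ᵛ ψ → extend₁ φ ≈ᵛ extend₁ ψ
  extend₁-cong φ≈ψ {a} {l} q l≤a = Σ<-cong (suc (suc a)) λ x x< →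
    φ≈ψ (isZero x ℕ.+ q) (≤-ascent x l≤a (ℕ.≤-pred x<))

  extend-cong : ∀ m {φ ψ} → φ ≈ᵛ ψ → extend m φ ≈ᵛ extend m ψ
  extend-cong zero    φ≈ψ = φ≈ψ
  extend-cong (suc m) φ≈ψ = extend₁-cong (extend-cong m φ≈ψ)

  -- `extend` recurses on the first appended entry, while the functional equation compares a
  -- sequence with what precedes its last entry. Iterates of `extend₁` may be peeled off at either
  -- end.
  extend-suc : ∀ m φ → extend (suc m) φ ≈ᵛ extend m (extend₁ φ)
  extend-suc zero    φ q _ = refl
  extend-suc (suc m) φ     = extend₁-cong (extend-suc m φ)

  extend-+ : ∀ m φ ψ → extend m (λ a l q → φ a l q + ψ a l q) ≈ᵛ
                       λ a l q → extend m φ a l q + extend m ψ a l q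
  extend-+ zero    φ ψ q _ = refl
  extend-+ (suc m) φ ψ {a} {l} q l≤a =
    trans (extend₁-cong (extend-+ m φ ψ) q l≤a) 
      (Σ<-+ (suc (suc a)) (append (extend m φ) a l q) (append (extend m ψ) a l q))

  extend-*ˡ : ∀ m x φ → extend m (λ a l q → x * φ a l q) ≈ᵛ
                        λ a l q → x * extend m φ a l q
  extend-*ˡ zero    x φ q _ = refl
  extend-*ˡ (suc m) x φ {a} {l} q l≤a =
    trans (extend₁-cong (extend-*ˡ m x φ) q l≤a) 
      (Σ<-*ˡ (suc (suc a)) x (append (extend m φ) a l q))

  monomial : Carrier → Carrier → Carrier → Statistic
  monomial z α β a l q = α ^ a * β ^ l * z ^ q

  geometric : ∀ x n → (x - 1#) * Σ< n (x ^_) ≈ x ^ n - 1#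
  geometric x zero    = trans (zeroʳ _) (sym (-‿inverseʳ 1#))
  geometric x (suc n) = begin
    (x - 1#) * (1# + Σ< n (λ i → x * x ^ i))
      ≈⟨ *-congˡ (+-congˡ (Σ<-*ˡ n x (x ^_))) ⟩
    (x - 1#) * (1# + x * Σ< n (x ^_))
      ≈⟨ solve 2 (λ x s → (x :- con (+ 1)) :* (con (+ 1) :+ x :* s) :=
           x :- con (+ 1) :+ x :* ((x :- con (+ 1)) :* s)) refl x _ ⟩
    x - 1# + x * ((x - 1#) * Σ< n (x ^_))
      ≈⟨ +-congˡ (*-congˡ (geometric x n)) ⟩
    x - 1# + x * (x ^ n - 1#)
      ≈⟨ solve 2 (λ x y → x :- con (+ 1) :+ x :* (y :- con (+ 1)) :=
           x :* y :- con (+ 1)) refl x _ ⟩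
    x * x ^ n - 1# ∎

  1^n≈1 : ∀ n → 1# ^ n ≈ 1#
  1^n≈1 zero    = refl
  1^n≈1 (suc n) = trans (*-identityˡ _) (1^n≈1 n)

  -- The appended entry is 0, which adds a factor z, or lies in 1, ..., l and makes no ascent, or
  -- lies in l + 1, ..., a + 1 and makes one. The last two ranges give geometric sums in β, whose
  -- denominators are cleared by β - 1.
  extend₁-monomial : ∀ z α β →
    (λ a l q → (β - 1#) * extend₁ (monomial z α β) a l q) ≈ᵛ
    (λ a l q → (z * (β - 1#) - β) * monomial z α 1# a l q
             + ((1# - α) * β * monomial z α β a l q
             + α * (β * β) * monomial z (α * β) 1# a l q))
  extend₁-monomial z α β {a} {l} q l≤a with ℕ.m≤n⇒∃[o]m+o≡n l≤a
  -- Here `j` is the gap a - l, so `suc j` of the admissible entries exceed `l`.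
  ... | j , ≡.refl = begin
    (β - 1#) * (φ (l ℕ.+ j) 0 (suc q) + Σ< (suc (l ℕ.+ j)) rest)
      ≡⟨ ≡.cong (λ n → (β - 1#) * (φ (l ℕ.+ j) 0 (suc q) + Σ< n rest)) (ℕ.+-suc l j) ⟨
    (β - 1#) * (φ (l ℕ.+ j) 0 (suc q) + Σ< (l ℕ.+ suc j) rest)
      ≈⟨ *-congˡ (+-congˡ (Σ<-++ l (suc j) rest)) ⟩
    (β - 1#) * (φ (l ℕ.+ j) 0 (suc q)
      + (Σ< l rest + Σ< (suc j) (λ i → rest (l ℕ.+ i))))
      ≈⟨ *-congˡ (+-congˡ (+-cong
           (trans (Σ<-cong l low) (Σ<-*ˡ l _ (β ^_)))
           (trans (Σ<-cong (suc j) high) (Σ<-*ˡ (suc j) _ (β ^_))))) ⟩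
    (β - 1#) * (A * 1# * (z * ζ)
      + (A * β * ζ * Σ< l (β ^_) + α * A * β * B * ζ * Σ< (suc j) (β ^_)))
      ≈⟨ solve 9 (λ α β z A B ζ S S′ o →
           (β :- o) :* (A :* o :* (z :* ζ) :+ (A :* β :* ζ :* S :+ α :* A :* β :* B :* ζ :* S′)) :=
           (β :- o) :* A :* o :* (z :* ζ) :+ (A :* β :* ζ :* ((β :- o) :* S)
             :+ α :* A :* β :* B :* ζ :* ((β :- o) :* S′)))
           refl α β z A B ζ _ _ 1# ⟩
    (β - 1#) * A * 1# * (z * ζ) + (A * β * ζ * ((β - 1#) * Σ< l (β ^_))
      + α * A * β * B * ζ * ((β - 1#) * Σ< (suc j) (β ^_)))
      ≈⟨ +-congˡ (+-cong (*-congˡ (geometric β l)) (*-congˡ (geometric β (suc j)))) ⟩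
    (β - 1#) * A * 1# * (z * ζ) + (A * β * ζ * (B - 1#)
      + α * A * β * B * ζ * (β * β ^ j - 1#))
      ≈⟨ solve 7 (λ α β z A B ζ J → let o = con (+ 1) in
           (β :- o) :* A :* o :* (z :* ζ) :+ (A :* β :* ζ :* (B :- o)
             :+ α :* A :* β :* B :* ζ :* (β :* J :- o)) :=
           (z :* (β :- o) :- β) :* (A :* o :* ζ) :+
             ((o :- α) :* β :* (A :* B :* ζ) :+ α :* (β :* β) :* (A :* (B :* J) :* o :* ζ)))
           refl α β z A B ζ _ ⟩
    (z * (β - 1#) - β) * (A * 1# * ζ)
      + ((1# - α) * β * (A * B * ζ) + α * (β * β) * (A * (B * β ^ j) * 1# * ζ))
      ≈⟨ +-cong (*-congˡ (*-congʳ (*-congˡ (1^n≈1 l))))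
          (+-congˡ (*-congˡ (*-congʳ (*-cong
            (trans (^-distrib-* α β (l ℕ.+ j)) (*-congˡ (^-homo-* β l j)))
            (1^n≈1 l))))) ⟨
    (z * (β - 1#) - β) * monomial z α 1# (l ℕ.+ j) l q
      + ((1# - α) * β * monomial z α β (l ℕ.+ j) l q
      + α * (β * β) * monomial z (α * β) 1# (l ℕ.+ j) l q) ∎
    where
    φ = monomial z α β
    A = α ^ (l ℕ.+ j)
    B = β ^ l
    ζ = z ^ q
    rest : ℕ → Carrier
    rest i = φ (ascent l (suc i) ℕ.+ (l ℕ.+ j)) (suc i) q
    low : ∀ i → i ℕ.< l → rest i ≈ A * β * ζ * β ^ i
    low i i<l rewrite ascent-≤ i<l =
      solve 4 (λ A β ζ Y → A :* (β :* Y) :* ζ := A :* β :* ζ :* Y) refl A β ζ (β ^ i)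
    high : ∀ i → i ℕ.< suc j → rest (l ℕ.+ i) ≈ α * A * β * B * ζ * β ^ i
    high i _ rewrite ascent-> (s≤s (ℕ.m≤m+n l i)) = trans
      (*-congʳ (*-congˡ (*-congˡ (^-homo-* β l i))))
      (solve 6 (λ α A β B ζ Y → α :* A :* (β :* (B :* Y)) :* ζ :=
                               α :* A :* β :* B :* ζ :* Y) refl α A β B ζ (β ^ i))

-- The kernel method

module KernelMethod (R : CommutativeRing 0ℓ 0ℓ) (F : Filtration R) where

  open CommutativeRing R
  open Filtration F
  open FormalSums F
  open Extensions R
  open IntegerSolver R
  open Sums R
  open Exp commutativeSemiring using (_^_; ^-congˡ)
  open import Algebra.Properties.Group +-group using (x∙y⁻¹≈ε⇒x≈y; x≈y⇒x∙y⁻¹≈ε)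
  open SetoidReasoning setoid

  multiple : ∀ c {x y} → x ≈ y → c * (x - y) ≈ 0#
  multiple c x≈y = trans (*-congˡ (x≈y⇒x∙y⁻¹≈ε x≈y)) (zeroʳ c)

  module FunctionalEquation
    (t : Carrier)
    (raise : ∀ {n y} → ord n y → ord (suc n) (t * y))
    (cancel : ∀ {x y} → t * x ≈ t * y → x ≈ y)
    (z : Carrier) (r : ℕ) (gf : Carrier → Carrier → Carrier)
    (gf-sum : ∀ α β → HasSum (λ m → t ^ m * extend m (monomial z α β) 1 1 r) (gf α β))
    where

    level : ℕ → Carrier → Carrier → Carrier
    level m α β = extend m (monomial z α β) 1 1 r

    -- `gf` is known only through the series that it sums, so congruence comes from the uniqueness
    -- of sums.
    gf-cong : ∀ {α α′ β β′} → α ≈ α′ → β ≈ β′ → gf α β ≈ gf α′ β′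
    gf-cong {α} {α′} {β} {β′} α≈ β≈ = HasSum-unique
      (HasSum-cong (λ m → *-congˡ (extend-cong m
        (λ {a} {l} q _ → *-congʳ (*-cong (^-congˡ a α≈) (^-congˡ l β≈))) r (s≤s z≤n)))
        (gf-sum α β))
      (gf-sum α′ β′)

    level-suc : ∀ m α β → (β - 1#) * level (suc m) α β ≈
      (z * (β - 1#) - β) * level m α 1#
        + ((1# - α) * β * level m α β + α * (β * β) * level m (α * β) 1#)
    level-suc m α β = begin
      (β - 1#) * level (suc m) α β
        ≈⟨ *-congˡ (extend-suc m φ r 1≤1) ⟩
      (β - 1#) * extend m (extend₁ φ) 1 1 r
        ≈⟨ extend-*ˡ m (β - 1#) (extend₁ φ) r 1≤1 ⟨
      extend m (λ a l q → (β - 1#) * extend₁ φ a l q) 1 1 r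
        ≈⟨ extend-cong m (extend₁-monomial z α β) r 1≤1 ⟩
      extend m (λ a l q → c₁ * monomial z α 1# a l q
        + (c₂ * φ a l q + c₃ * monomial z (α * β) 1# a l q)) 1 1 r
        ≈⟨ extend-+ m (λ a l q → c₁ * monomial z α 1# a l q)
             (λ a l q → c₂ * φ a l q + c₃ * monomial z (α * β) 1# a l q) r 1≤1 ⟩
      extend m (λ a l q → c₁ * monomial z α 1# a l q) 1 1 r
        + extend m (λ a l q → c₂ * φ a l q + c₃ * monomial z (α * β) 1# a l q) 1 1 r
        ≈⟨ +-congˡ (extend-+ m (λ a l q → c₂ * φ a l q)
             (λ a l q → c₃ * monomial z (α * β) 1# a l q) r 1≤1) ⟩
      extend m (λ a l q → c₁ * monomial z α 1# a l q) 1 1 r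
        + (extend m (λ a l q → c₂ * φ a l q) 1 1 r
           + extend m (λ a l q → c₃ * monomial z (α * β) 1# a l q) 1 1 r)
        ≈⟨ +-cong (extend-*ˡ m c₁ (monomial z α 1#) r 1≤1)
             (+-cong (extend-*ˡ m c₂ φ r 1≤1)
                     (extend-*ˡ m c₃ (monomial z (α * β) 1#) r 1≤1)) ⟩
      c₁ * level m α 1# + (c₂ * level m α β + c₃ * level m (α * β) 1#) ∎
      where
      φ  = monomial z α β
      c₁ = z * (β - 1#) - β
      c₂ = (1# - α) * β
      c₃ = α * (β * β)
      1≤1 : 1 ≤ 1
      1≤1 = s≤s z≤n

    -- This is `level-suc` weighted by t^(m+1) and summed over m, with the bare sequence 0ʳ1, in
    -- state (1, 1, r), as the extra initial term. The factor β - 1 stays, since it need not be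
    -- invertible.
    gf-functional : ∀ α β → (β - 1#) * gf α β ≈
      (β - 1#) * (α * β * z ^ r) +
      t * ((z * (β - 1#) - β) * gf α 1#
        + ((1# - α) * β * gf α β + α * (β * β) * gf (α * β) 1#))
    gf-functional α β = trans
      (HasSum-unique (HasSum-* (β - 1#) (gf-sum α β))
        (HasSum-shift raise
          (HasSum-+ (HasSum-* c₁ (gf-sum α 1#))
            (HasSum-+ (HasSum-* c₂ (gf-sum α β)) (HasSum-* c₃ (gf-sum (α * β) 1#))))
          terms))
      (+-congʳ (*-congˡ (solve 3 (λ α β y → let o = con (+ 1) in
        o :* (α :* o :* (β :* o) :* y) := α :* β :* y) refl α β (z ^ r))))
      where
      c₁ = z * (β - 1#) - β
      c₂ = (1# - α) * β
      c₃ = α * (β * β)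
      terms : ∀ m → (β - 1#) * (t ^ suc m * level (suc m) α β) ≈
        t * (c₁ * (t ^ m * level m α 1#)
          + (c₂ * (t ^ m * level m α β) + c₃ * (t ^ m * level m (α * β) 1#)))
      terms m = begin
        (β - 1#) * (t * t ^ m * level (suc m) α β)
          ≈⟨ solve 4 (λ b t p y → b :* (t :* p :* y) := t :* p :* (b :* y)) refl
               (β - 1#) t (t ^ m) _ ⟩
        t * t ^ m * ((β - 1#) * level (suc m) α β)
          ≈⟨ *-congˡ (level-suc m α β) ⟩
        t * t ^ m * (c₁ * level m α 1# + (c₂ * level m α β + c₃ * level m (α * β) 1#))
          ≈⟨ solve 8 (λ t p c₁ c₂ c₃ x y z →
               t :* p :* (c₁ :* x :+ (c₂ :* y :+ c₃ :* z)) :=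
               t :* (c₁ :* (p :* x) :+ (c₂ :* (p :* y) :+ c₃ :* (p :* z)))) refl
               t (t ^ m) c₁ c₂ c₃ _ _ _ ⟩
        t * (c₁ * (t ^ m * level m α 1#)
          + (c₂ * (t ^ m * level m α β) + c₃ * (t ^ m * level m (α * β) 1#))) ∎

    -- Collecting the two occurrences of `gf α β` exposes the kernel. This form serves the point (u,
    -- v), where the kernel is invertible; where it vanishes, `E-step` starts from `gf-functional`.
    gf-kernel : ∀ α β → (β * (1# + t * (α - 1#)) - 1#) * gf α β ≈
      α * β * z ^ r * (β - 1#)
        + t * ((z * (β - 1#) - β) * gf α 1# + α * (β * β) * gf (α * β) 1#)
    gf-kernel α β = x∙y⁻¹≈ε⇒x≈y _ _ (trans
      (solve 8 (λ t z α β y f f₁ f₂ → let o = con (+ 1) in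
        (β :* (o :+ t :* (α :- o)) :- o) :* f
          :- (α :* β :* y :* (β :- o)
              :+ t :* ((z :* (β :- o) :- β) :* f₁ :+ α :* (β :* β) :* f₂)) :=
        o :* ((β :- o) :* f :- ((β :- o) :* (α :* β :* y) :+
          t :* ((z :* (β :- o) :- β) :* f₁
            :+ ((o :- α) :* β :* f :+ α :* (β :* β) :* f₂)))))
        refl t z α β (z ^ r) (gf α β) (gf α 1#) (gf (α * β) 1#))
      (multiple 1# (gf-functional α β)))

    -- The kernel β (1 + t (α - 1)) - 1 vanishes at α = x / d k, β = d k / d (1 + k).
    module Iteration
      (x : Carrier) (d g P J : ℕ → Carrier)
      (d-0 : d 0 ≈ 1#)
      (d-eq : ∀ k → d k ≈ x - (1# - t) ^ k * (x - 1#))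
      (g-eq : ∀ k → g (suc k) ≈ x - (1# - z * t) * (1# - t) ^ k * (x - 1#))
      (P-0 : P 0 ≈ 1#)
      (P-suc : ∀ k → P (suc k) ≈ P k * g (suc k))
      (J-inverse : ∀ k → d k * d (suc k) * P (suc k) * J k ≈ 1#)
      where

      -- `J k` inverts a product of several factors, so multiplying it by all of them but one
      -- inverts the remaining one: `e k` is the inverse of `d k`, and `p k` below that of `P k`.
      e : ℕ → Carrier
      e k = d (suc k) * P (suc k) * J k

      e-inverse : ∀ k → d k * e k ≈ 1#
      e-inverse k = trans
        (solve 4 (λ a b c j → a :* (b :* c :* j) := a :* b :* c :* j) refl _ _ _ _)
        (J-inverse k)

      p : ℕ → Carrier
      p k = g (suc k) * (d k * d (suc k) * J k)

      p-inverse : ∀ k → P k * p k ≈ 1#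
      p-inverse k = begin
        P k * (g (suc k) * (d k * d (suc k) * J k))
          ≈⟨ solve 5 (λ P g d d′ j → P :* (g :* (d :* d′ :* j)) := d :* d′ :* (P :* g) :* j)
               refl (P k) (g (suc k)) (d k) (d (suc k)) (J k) ⟩
        d k * d (suc k) * (P k * g (suc k)) * J k
          ≈⟨ *-congʳ (*-congˡ (P-suc k)) ⟨
        d k * d (suc k) * P (suc k) * J k
          ≈⟨ J-inverse k ⟩
        1# ∎

      inverse-unique : ∀ {a b b′} → a * b ≈ 1# → a * b′ ≈ 1# → b ≈ b′
      inverse-unique {a} {b} {b′} ab≈1 ab′≈1 = begin
        b             ≈⟨ *-identityʳ b ⟨
        b * 1#        ≈⟨ *-congˡ ab′≈1 ⟨
        b * (a * b′)  ≈⟨ solve 3 (λ a b b′ → b :* (a :* b′) := b′ :* (a :* b)) refl a b b′ ⟩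
        b′ * (a * b)  ≈⟨ *-congˡ ab≈1 ⟩
        b′ * 1#       ≈⟨ *-identityʳ b′ ⟩
        b′            ∎

      p-0 : p 0 ≈ 1#
      p-0 = inverse-unique (p-inverse 0) (trans (*-identityʳ _) P-0)

      p-suc : ∀ k → p k ≈ p (suc k) * g (suc k)
      p-suc k = inverse-unique (p-inverse k) (begin
        P k * (p (suc k) * g (suc k))
          ≈⟨ solve 3 (λ a b c → a :* (b :* c) := a :* c :* b) refl _ _ _ ⟩
        P k * g (suc k) * p (suc k)  ≈⟨ *-congʳ (P-suc k) ⟨
        P (suc k) * p (suc k)        ≈⟨ p-inverse (suc k) ⟩
        1# ∎)

      -- Recombines the separate inverses produced by the iteration into the single denominator of
      -- the summand.
      p-e-e : ∀ k → p (suc k) * (e k * e (suc k)) ≈ J k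
      p-e-e k = inverse-unique
        (begin
          d k * d (suc k) * P (suc k) * (p (suc k) * (e k * e (suc k)))
            ≈⟨ solve 6 (λ d d′ P p e e′ → d :* d′ :* P :* (p :* (e :* e′)) :=
                 (d :* e) :* ((d′ :* e′) :* (P :* p))) refl _ _ _ _ _ _ ⟩
          (d k * e k) * ((d (suc k) * e (suc k)) * (P (suc k) * p (suc k)))
            ≈⟨ *-cong (e-inverse k) (*-cong (e-inverse (suc k)) (p-inverse (suc k))) ⟩
          1# * (1# * 1#)
            ≈⟨ trans (*-identityˡ _) (*-identityˡ _) ⟩
          1# ∎)
        (J-inverse k)

      -- With the factor `e k` the recurrence carries `gf` at step `suc k` with the plain
      -- coefficient `x`; otherwise a factor `d k * e (suc k)` would accumulate.
      E : ℕ → Carrier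
      E k = e k * gf (x * e k) 1#

      c : Carrier
      c = z ^ r * (x * (1# - x))

      -- At α = x / d k, β = d k / d (suc k) the unknown `gf α β` drops out of the functional
      -- equation, and α β = x / d (suc k) leaves only two neighbouring values of `gf`.
      E-step : ∀ k → g (suc k) * E k ≈
                     c * ((1# - t) ^ k * (e k * e (suc k))) + x * E (suc k)
      E-step k = begin
        g (suc k) * (ε * f)
          -- `g (suc k)` is D - z t (D - x); times -ε′ this is the coefficient of `f` in `K`.
          ≈⟨ *-congʳ (trans (g-eq k) (trans
               (solve 4 (λ t z x w → let o = con (+ 1) in
                 x :- (o :- z :* t) :* w :* (x :- o) :=
                 x :- w :* (x :- o) :- z :* (t :* (x :- w :* (x :- o) :- x))) refl t z x w)
               (sym (+-cong (d-eq k) (-‿cong (*-congˡ (*-congˡ (+-congʳ (d-eq k))))))))) ⟩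
        (D - z * (t * (D - x))) * (ε * f)
          ≈⟨ *-identityʳ _ ⟨
        (D - z * (t * (D - x))) * (ε * f) * 1#
          ≈⟨ *-congˡ (e-inverse (suc k)) ⟨
        (D - z * (t * (D - x))) * (ε * f) * (D′ * ε′)
          -- The factor D′ ε′ = 1 was inserted so that this becomes a polynomial identity: the last
          -- summand is -D′ ε times `K`, which vanishes.
          ≈⟨ solve 10 (λ t z x D D′ ε ε′ f f′ y →
               (D :- z :* (t :* (D :- x))) :* (ε :* f) :* (D′ :* ε′) :=
               ((D :- x) :* (x :* ε′) :* y :* ε :+ x :* ε′ :* f′ :* (D :* ε)) :* (D′ :* ε′)
               :+ :- (D′ :* ε) :* ((z :* (t :* ((D :- x) :* ε′)) :- D :* ε′) :* f
                  :+ ((D :- x) :* ε′ :* (x :* ε′ :* y) :+ x :* ε′ :* (D :* ε′) :* f′))) refl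
               t z x D D′ ε ε′ f f′ y ⟩
        ((D - x) * (x * ε′) * y * ε + x * ε′ * f′ * (D * ε)) * (D′ * ε′)
          + - (D′ * ε) * ((z * (t * u) - D * ε′) * f
              + (u * (x * ε′ * y) + x * ε′ * (D * ε′) * f′))
          ≈⟨ +-cong (*-cong (+-cong (*-congʳ (*-congʳ (*-congʳ (+-congʳ (d-eq k)))))
               (*-congˡ (e-inverse k))) (e-inverse (suc k))) (trans (*-congˡ vanish) (zeroʳ _)) ⟩
        ((x - w * (x - 1#) - x) * (x * ε′) * y * ε + x * ε′ * f′ * 1#) * 1# + 0#
          ≈⟨ solve 6 (λ x w y ε ε′ f′ → let o = con (+ 1) in
               ((x :- w :* (x :- o) :- x) :* (x :* ε′) :* y :* ε :+ x :* ε′ :* f′ :* o) :* o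
                 :+ con (+ 0) :=
               y :* (x :* (o :- x)) :* (w :* (ε :* ε′)) :+ x :* (ε′ :* f′)) refl x w y ε ε′ f′ ⟩
        c * (w * (ε * ε′)) + x * (ε′ * f′) ∎
        where
        w  = (1# - t) ^ k
        y  = z ^ r
        D  = d k
        D′ = d (suc k)
        ε  = e k
        ε′ = e (suc k)
        α  = x * ε
        β  = D * ε′
        -- Both (β - 1) / t and (1 - α) β equal `u`, as shown below; their equality is exactly the
        -- vanishing of the kernel.
        u  = (D - x) * ε′
        f  = gf α 1#
        f′ = gf (x * ε′) 1#

        β-1≈tu : β - 1# ≈ t * u
        β-1≈tu = begin
          D * ε′ - 1#                ≈⟨ +-congˡ (-‿cong (e-inverse (suc k))) ⟨
          D * ε′ - D′ * ε′
            ≈⟨ +-cong (*-congʳ (d-eq k)) (-‿cong (*-congʳ (d-eq (suc k)))) ⟩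
          (x - w * (x - 1#)) * ε′ - (x - (1# - t) * w * (x - 1#)) * ε′
            ≈⟨ solve 4 (λ t x w ε′ → let o = con (+ 1) in
                 (x :- w :* (x :- o)) :* ε′ :- (x :- (o :- t) :* w :* (x :- o)) :* ε′ :=
                 t :* ((x :- w :* (x :- o) :- x) :* ε′)) refl t x w ε′ ⟩
          t * ((x - w * (x - 1#) - x) * ε′)  ≈⟨ *-congˡ (*-congʳ (+-congʳ (d-eq k))) ⟨
          t * u                      ∎

        αβ≈xε′ : α * β ≈ x * ε′
        αβ≈xε′ = begin
          x * ε * (D * ε′)  ≈⟨ solve 4 (λ x ε D ε′ → x :* ε :* (D :* ε′) := x :* ε′ :* (D :* ε))
                                 refl x ε D ε′ ⟩
          x * ε′ * (D * ε)  ≈⟨ trans (*-congˡ (e-inverse k)) (*-identityʳ _) ⟩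
          x * ε′            ∎

        [1-α]β≈u : (1# - α) * β ≈ u
        [1-α]β≈u = begin
          (1# - x * ε) * (D * ε′)
            ≈⟨ solve 4 (λ x ε D ε′ → (con (+ 1) :- x :* ε) :* (D :* ε′) :=
                 (D :- x :* (D :* ε)) :* ε′) refl x ε D ε′ ⟩
          (D - x * (D * ε)) * ε′
            ≈⟨ *-congʳ (+-congˡ (-‿cong (trans (*-congˡ (e-inverse k)) (*-identityʳ x)))) ⟩
          u ∎

        K : Carrier
        K = (z * (t * u) - β) * f + (u * (x * ε′ * y) + x * ε′ * β * f′)

        -- The functional equation reads t u Γ = t (u Γ + K). Cancelling t and then u Γ removes the
        -- unknown value Γ and leaves `K`.
        vanish : K ≈ 0#
        vanish = begin
          K
            ≈⟨ solve 2 (λ g K → K := con (+ 1) :* (g :+ K :- g)) refl (u * Γ) K ⟩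
          1# * (u * Γ + K - u * Γ)       ≈⟨ multiple 1# (sym (cancel (begin
            t * (u * Γ)                  ≈⟨ *-assoc t u Γ ⟨
            t * u * Γ                    ≈⟨ *-congʳ β-1≈tu ⟨
            (β - 1#) * Γ                 ≈⟨ gf-functional α β ⟩
            (β - 1#) * (α * β * y) + t * ((z * (β - 1#) - β) * f
              + ((1# - α) * β * Γ + α * (β * β) * gf (α * β) 1#))
              ≈⟨ +-cong (*-cong β-1≈tu (*-congʳ αβ≈xε′)) (*-congˡ (+-cong
                   (*-congʳ (+-congʳ (*-congˡ β-1≈tu)))
                   (+-cong (*-congʳ [1-α]β≈u) (*-cong
                     (trans (sym (*-assoc α β β)) (*-congʳ αβ≈xε′))
                     (gf-cong αβ≈xε′ refl))))) ⟩
            t * u * (x * ε′ * y) + t * ((z * (t * u) - β) * f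
              + (u * Γ + x * ε′ * β * f′))
              ≈⟨ solve 6 (λ t u m a g b → t :* u :* m :+ t :* (a :+ (u :* g :+ b)) :=
                   t :* (u :* g :+ (a :+ (u :* m :+ b)))) refl
                   t u (x * ε′ * y) ((z * (t * u) - β) * f) Γ (x * ε′ * β * f′) ⟩
            t * (u * Γ + K)              ∎))) ⟩
          0#                             ∎
          where
          Γ = gf α β

      -- Unrolls `E-step` n times, with `p` collecting the inverses of the factors `g`. The
      -- remainder carries x^n, from which convergence will follow once x has positive order in u.
      gf-truncated : ∀ n → gf x 1# ≈
        Σ< n (λ k → c * (x ^ k * ((1# - t) ^ k * J k))) + x ^ n * (p n * E n)
      gf-truncated zero = begin
        gf x 1#
          ≈⟨ gf-cong (trans (sym (*-identityʳ x)) (*-congˡ (sym e-0))) refl ⟩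
        gf (x * e 0) 1#
          ≈⟨ solve 1 (λ f → let o = con (+ 1) in f := con (+ 0) :+ o :* (o :* (o :* f))) refl _ ⟩
        0# + 1# * (1# * (1# * gf (x * e 0) 1#))
          ≈⟨ +-congˡ (*-congˡ (*-cong p-0 (*-congʳ e-0))) ⟨
        0# + 1# * (p 0 * E 0) ∎
        where
        e-0 : e 0 ≈ 1#
        e-0 = inverse-unique (e-inverse 0) (trans (*-identityʳ _) d-0)
      gf-truncated (suc n) = begin
        gf x 1#
          ≈⟨ gf-truncated n ⟩
        S + x ^ n * (p n * E n)
          ≈⟨ +-congˡ (*-congˡ (trans (*-congʳ (p-suc n))
               (trans (*-assoc _ _ _) (*-congˡ (E-step n))))) ⟩
        S + x ^ n * (p (suc n) * (c * (w * (e n * e (suc n))) + x * E (suc n)))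
          ≈⟨ solve 8 (λ S X p c w ee x E →
               S :+ X :* (p :* (c :* (w :* ee) :+ x :* E)) :=
               S :+ c :* (X :* (w :* (p :* ee))) :+ x :* X :* (p :* E)) refl
               S (x ^ n) (p (suc n)) c w (e n * e (suc n)) x (E (suc n)) ⟩
        S + c * (x ^ n * (w * (p (suc n) * (e n * e (suc n)))))
          + x ^ suc n * (p (suc n) * E (suc n))
          ≈⟨ +-congʳ (trans (+-congˡ (*-congˡ (*-congˡ (*-congˡ (p-e-e n))))) (sym (Σ<-last n _))) ⟩
        Σ< (suc n) (λ k → c * (x ^ k * ((1# - t) ^ k * J k)))
          + x ^ suc n * (p (suc n) * E (suc n)) ∎
        where
        S = Σ< n (λ k → c * (x ^ k * ((1# - t) ^ k * J k)))
        w = (1# - t) ^ n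

-- Summation and inversion in FPS

module 𝔽 = CommutativeRing FPS-commutativeRing
open Exp 𝔽.commutativeSemiring using (^-distrib-*) renaming (_^_ to _^ᶠ_)

^^≡^ : ∀ f n → f ^^ n ≡ f ^ᶠ n
^^≡^ f zero    = ≡.refl
^^≡^ f (suc n) = ≡.cong (f ⊗_) (^^≡^ f n)

sumTo-zero : ∀ n {f : ℕ → ℤ} → (∀ i → i ≤ n → f i ≡ + 0) → sumTo n f ≡ + 0
sumTo-zero zero    f≡0 = f≡0 0 z≤n
sumTo-zero (suc n) f≡0 =
  ≡.cong₂ ℤ._+_ (sumTo-zero n (λ i i≤n → f≡0 i (ℕ.m≤n⇒m≤1+n i≤n))) (f≡0 (suc n) ℕ.≤-refl)

open Sums FPS-commutativeRing using (Σ<; Σ<-last; Σ<-++)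

Σ<≡sumTo : ∀ n h a b c d → Σ< (suc n) h a b c d ≡ sumTo n (λ k → h k a b c d)
Σ<≡sumTo zero    h a b c d = ℤ.+-identityʳ _
Σ<≡sumTo (suc n) h a b c d = ≡.trans (Σ<-last (suc n) h a b c d)
  (≡.cong (λ s → s ℤ.+ h (suc n) a b c d) (Σ<≡sumTo n h a b c d))

Weight : Set
Weight = ℕ → ℕ → ℕ → ℕ → ℕ

-- Such a weight is additive on products of monomials, so order of vanishing with respect to it is a
-- filtration.
Additive : Weight → Set
Additive ω = ∀ {a b c d i j k l} → i ≤ a → j ≤ b → k ≤ c → l ≤ d →
  ω i j k l ℕ.+ ω (a ∸ i) (b ∸ j) (c ∸ k) (d ∸ l) ≡ ω a b c d

module Degree (ω : Weight) (ω-additive : Additive ω) where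

  ord : ℕ → FPS → Set
  ord n f = ∀ a b c d → ω a b c d ℕ.< n → f a b c d ≡ + 0

  -- If the two weights add up to less than m + n, the first is below m or the second is below n, so
  -- each term has a zero factor.
  ord-⊗ : ∀ {m n} {f g} → ord m f → ord n g → ord (m ℕ.+ n) (f ⊗ g)
  ord-⊗ {m} {n} {f} {g} f∈ g∈ a b c d ω< =
    sumTo-zero a λ i i≤a → sumTo-zero b λ j j≤b →
    sumTo-zero c λ k k≤c → sumTo-zero d λ l l≤d → term i≤a j≤b k≤c l≤d
    where
    term : ∀ {i j k l} → i ≤ a → j ≤ b → k ≤ c → l ≤ d →
           f i j k l ℤ.* g (a ∸ i) (b ∸ j) (c ∸ k) (d ∸ l) ≡ + 0
    term {i} {j} {k} {l} i≤a j≤b k≤c l≤d with ω i j k l ℕ.<? m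
    ... | yes ω<m = ≡.cong (λ x → x ℤ.* _) (f∈ i j k l ω<m)
    ... | no  ω≮m = ≡.trans
      (≡.cong (λ x → f i j k l ℤ.* x) (g∈ _ _ _ _ (ℕ.+-cancelˡ-< m _ _ (ℕ.≤-<-trans
        (ℕ.+-monoˡ-≤ _ (ℕ.≮⇒≥ ω≮m))
        (≡.subst (ℕ._< m ℕ.+ n) (≡.sym (ω-additive i≤a j≤b k≤c l≤d)) ω<)))))
      (ℤ.*-zeroʳ (f i j k l))

  filtration : Filtration FPS-commutativeRing
  filtration = record
    { ord       = ord
    ; ord-cong  = λ f≋g f∈ a b c d ω< → ≡.trans (≡.sym (f≋g a b c d)) (f∈ a b c d ω<)
    ; ord-+     = λ f∈ g∈ a b c d ω< → ≡.cong₂ ℤ._+_ (f∈ a b c d ω<) (g∈ a b c d ω<)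
    ; ord-*     = λ f g∈ → ord-⊗ {0} {_} {f} (λ _ _ _ _ ()) g∈
    ; ord-0     = λ _ _ _ _ ()
    ; separated = λ f∈ a b c d → f∈ (suc (ω a b c d)) a b c d ℕ.≤-refl
    }

  ord-^ : ∀ {f} → ord 1 f → ∀ n → ord n (f ^ᶠ n)
  ord-^ f∈ zero    = λ _ _ _ _ ()
  ord-^ f∈ (suc n) = ord-⊗ f∈ (ord-^ f∈ n)

  ord-^-⊗ : ∀ {f} → ord 1 f → ∀ n g → ord n (f ^ᶠ n ⊗ g)
  ord-^-⊗ {f} f∈ n g = ≡.subst (λ m → ord m (f ^ᶠ n ⊗ g)) (ℕ.+-identityʳ n)
    (ord-⊗ {n} {0} {f ^ᶠ n} {g} (ord-^ f∈ n) (λ _ _ _ _ ()))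

  open FormalSums filtration public

  -- Cutting off at the weight of the coefficient makes `inv1` the limit for total degree and `sumU`
  -- the limit for degree in u by computation, so `limit-sum` applies to both.
  limit : (ℕ → FPS) → FPS
  limit h a b c d = sumTo (ω a b c d) (λ k → h k a b c d)

  -- In a coefficient of weight ω < n the first ω + 1 terms already give the limit, and every later
  -- term has order above ω and contributes 0.
  limit-sum : ∀ {h} → (∀ k → ord k (h k)) → HasSum h (limit h)
  limit-sum {h} h∈ n a b c d ω<n with ℕ.m≤n⇒∃[o]m+o≡n ω<n
  ... | j , ≡.refl = ≡.trans
    (≡.cong (λ s → limit h a b c d ℤ.- s) (begin
      Σ< (suc ω₀ ℕ.+ j) h a b c d
        ≡⟨ Σ<-++ (suc ω₀) j h a b c d ⟩
      Σ< (suc ω₀) h a b c d ℤ.+ Σ< j (λ i → h (suc ω₀ ℕ.+ i)) a b c d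
        ≡⟨ ≡.cong₂ ℤ._+_ (Σ<≡sumTo ω₀ h a b c d)
             (tail j (λ i → suc ω₀ ℕ.+ i) (λ i → s≤s (ℕ.m≤m+n ω₀ i))) ⟩
      limit h a b c d ℤ.+ + 0
        ≡⟨ ℤ.+-identityʳ _ ⟩
      limit h a b c d ∎))
    (ℤ.+-inverseʳ (limit h a b c d))
    where
    open ≡.≡-Reasoning
    ω₀ = ω a b c d
    tail : ∀ n (k : ℕ → ℕ) → (∀ i → ω₀ ℕ.< k i) → Σ< n (λ i → h (k i)) a b c d ≡ + 0
    tail zero    k ω< = ≡.refl
    tail (suc n) k ω< =
      ≡.cong₂ ℤ._+_ (h∈ (k 0) a b c d (ω< 0)) (tail n (λ i → k (suc i)) (λ i → ω< (suc i)))

tDegree uDegree totalDegree : Weight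
tDegree a b c d = a
uDegree a b c d = b
totalDegree a b c d = a ℕ.+ b ℕ.+ c ℕ.+ d

totalDegree-additive : Additive totalDegree
totalDegree-additive {a} {b} {c} {d} {i} {j} {k} {l} i≤a j≤b k≤c l≤d = begin
  i ℕ.+ j ℕ.+ k ℕ.+ l ℕ.+ (a ∸ i ℕ.+ (b ∸ j) ℕ.+ (c ∸ k) ℕ.+ (d ∸ l))
    ≡⟨ interchange (i ℕ.+ j ℕ.+ k) l _ _ ⟩
  i ℕ.+ j ℕ.+ k ℕ.+ (a ∸ i ℕ.+ (b ∸ j) ℕ.+ (c ∸ k)) ℕ.+ (l ℕ.+ (d ∸ l))
    ≡⟨ ≡.cong₂ ℕ._+_ (interchange (i ℕ.+ j) k _ _) (ℕ.m+[n∸m]≡n l≤d) ⟩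
  i ℕ.+ j ℕ.+ (a ∸ i ℕ.+ (b ∸ j)) ℕ.+ (k ℕ.+ (c ∸ k)) ℕ.+ d
    ≡⟨ ≡.cong (ℕ._+ d) (≡.cong₂ ℕ._+_ (interchange i j _ _) (ℕ.m+[n∸m]≡n k≤c)) ⟩
  i ℕ.+ (a ∸ i) ℕ.+ (j ℕ.+ (b ∸ j)) ℕ.+ c ℕ.+ d
    ≡⟨ ≡.cong (λ n → n ℕ.+ c ℕ.+ d) (≡.cong₂ ℕ._+_ (ℕ.m+[n∸m]≡n i≤a) (ℕ.m+[n∸m]≡n j≤b)) ⟩
  a ℕ.+ b ℕ.+ c ℕ.+ d ∎
  where
  open ≡.≡-Reasoning
  open ℕ+ using (interchange)

module tAdic = Degree tDegree (λ i≤a _ _ _ → ℕ.m+[n∸m]≡n i≤a)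
module uAdic = Degree uDegree (λ _ j≤b _ _ → ℕ.m+[n∸m]≡n j≤b)
module total = Degree totalDegree totalDegree-additive

module _ (R : CommutativeRing 0ℓ 0ℓ) where
  open CommutativeRing R
  open Exp commutativeSemiring using (_^_)
  open IntegerSolver R
  open Extensions R using (geometric)

  -- The partial sums of x (1 - x)^k approach 1 with error (1 - x)^n: this is `geometric` with base
  -- 1 - x, for which base minus one is -x.
  geometric-remainder : ∀ x n → 1# - Sums.Σ< R n (λ k → x * (1# - x) ^ k) ≈ (1# - x) ^ n
  geometric-remainder x n = trans
    (+-congˡ (-‿cong (Sums.Σ<-*ˡ R n x ((1# - x) ^_))))
    (trans (solve 2 (λ x s → let o = con (+ 1) in
      o :- x :* s := (o :- x :- o) :* s :+ o) refl x _)
    (trans (+-congʳ (geometric (1# - x) n))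
      (solve 1 (λ y → y :- con (+ 1) :+ con (+ 1) := y) refl _)))

-- Both sides are the sum of f (1 - f)^k: the left by linearity, the right by `geometric-remainder`,
-- as 1 - f has no constant term.
inv1-inverse : ∀ f → f 0 0 0 0 ≡ + 1 → f ⊗ inv1 f ≋ 𝟙
inv1-inverse f f₀≡1 = total.HasSum-unique
  {λ k → f ⊗ (𝟙 ⊖ f) ^ᶠ k}
  (total.HasSum-* f {λ k → (𝟙 ⊖ f) ^ᶠ k} {inv1 f}
    (total.HasSum-cong {λ k → (𝟙 ⊖ f) ^^ k} {λ k → (𝟙 ⊖ f) ^ᶠ k} {inv1 f}
      (λ k → 𝔽.reflexive (^^≡^ (𝟙 ⊖ f) k))
      (total.limit-sum λ k →
        ≡.subst (total.ord k) (≡.sym (^^≡^ (𝟙 ⊖ f) k)) (total.ord-^ 1-f∈ k))))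
  (λ n → Filtration.ord-cong total.filtration {n}
    (𝔽.sym (geometric-remainder FPS-commutativeRing f n)) (total.ord-^ 1-f∈ n))
  where
  1-f∈ : total.ord 1 (𝟙 ⊖ f)
  1-f∈ zero zero zero zero _ rewrite f₀≡1 = ≡.refl
  1-f∈ zero zero zero (suc d) (s≤s ())
  1-f∈ zero zero (suc c) d (s≤s ())
  1-f∈ zero (suc b) c d (s≤s ())
  1-f∈ (suc a) b c d (s≤s ())

inv-inverse : ∀ f {ε} → f 0 0 0 0 ≡ ε → ε ℤ.* ε ≡ + 1 → f ⊗ inv f ≋ 𝟙
inv-inverse f ≡.refl ε²≡1 = begin
  f ⊗ (η ⊗ inv1 (η ⊗ f))  ≈⟨ 𝔽.*-assoc f η (inv1 (η ⊗ f)) ⟨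
  f ⊗ η ⊗ inv1 (η ⊗ f)    ≈⟨ 𝔽.*-congʳ {inv1 (η ⊗ f)} (𝔽.*-comm f η) ⟩
  -- The constant term of `η ⊗ f` computes to ε * ε, so `ε²≡1` is the hypothesis needed here.
  η ⊗ f ⊗ inv1 (η ⊗ f)    ≈⟨ inv1-inverse (η ⊗ f) ε²≡1 ⟩
  𝟙                       ∎
  where
  open SetoidReasoning 𝔽.setoid
  η = const (f 0 0 0 0)

-- Multiplication by the variables, and coefficients of monomials

T≋X : T ≋ PS₄.X
T≋X zero          b       c       d       = ≡.refl
T≋X (suc zero)    zero    zero    zero    = ≡.refl
T≋X (suc zero)    zero    zero    (suc d) = ≡.refl
T≋X (suc zero)    zero    (suc c) d       = ≡.refl
T≋X (suc zero)    (suc b) c       d       = ≡.refl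
T≋X (suc (suc a)) b       c       d       = ≡.refl

U≋X : U ≋ PS₄.C PS₃.X
U≋X zero    zero          c       d       = ≡.refl
U≋X zero    (suc zero)    zero    zero    = ≡.refl
U≋X zero    (suc zero)    zero    (suc d) = ≡.refl
U≋X zero    (suc zero)    (suc c) d       = ≡.refl
U≋X zero    (suc (suc b)) c       d       = ≡.refl
U≋X (suc a) b             c       d       = ≡.refl

V≋X : V ≋ PS₄.C (PS₃.C PS₂.X)
V≋X zero    zero    zero          d       = ≡.refl
V≋X zero    zero    (suc zero)    zero    = ≡.refl
V≋X zero    zero    (suc zero)    (suc d) = ≡.refl
V≋X zero    zero    (suc (suc c)) d       = ≡.refl
V≋X zero    (suc b) c             d       = ≡.refl
V≋X (suc a) b       c             d       = ≡.refl

Z≋X : Z ≋ PS₄.C (PS₃.C (PS₂.C PS₁.X))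
Z≋X zero    zero    zero    zero          = ≡.refl
Z≋X zero    zero    zero    (suc zero)    = ≡.refl
Z≋X zero    zero    zero    (suc (suc d)) = ≡.refl
Z≋X zero    zero    (suc c) d             = ≡.refl
Z≋X zero    (suc b) c       d             = ≡.refl
Z≋X (suc a) b       c       d             = ≡.refl

T⊗-suc : ∀ f a b c d → (T ⊗ f) (suc a) b c d ≡ f a b c d
T⊗-suc f a b c d = ≡.trans (⊗≋* T f (suc a) b c d)
  (≡.trans (P₄.*-congʳ {f} T≋X (suc a) b c d) (PS₄.X-*ˢ-suc f a b c d))

U⊗ : ∀ f a b c d → (U ⊗ f) a b c d ≡ (PS₃.X P₃.* f a) b c d
U⊗ f a b c d = ≡.trans (⊗≋* U f a b c d)
  (≡.trans (P₄.*-congʳ {f} U≋X a b c d) (PS₄.C-*ˢ PS₃.X f a b c d))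

V⊗ : ∀ f a b c d → (V ⊗ f) a b c d ≡ (PS₂.X P₂.* f a b) c d
V⊗ f a b c d = ≡.trans (⊗≋* V f a b c d) (≡.trans (P₄.*-congʳ {f} V≋X a b c d)
  (≡.trans (PS₄.C-*ˢ (PS₃.C PS₂.X) f a b c d) (PS₃.C-*ˢ PS₂.X (f a) b c d)))

Z⊗ : ∀ f a b c d → (Z ⊗ f) a b c d ≡ (PS₁.X P₁.* f a b c) d
Z⊗ f a b c d = ≡.trans (⊗≋* Z f a b c d) (≡.trans (P₄.*-congʳ {f} Z≋X a b c d)
  (≡.trans (PS₄.C-*ˢ (PS₃.C (PS₂.C PS₁.X)) f a b c d)
    (≡.trans (PS₃.C-*ˢ (PS₂.C PS₁.X) (f a) b c d) (PS₂.C-*ˢ PS₁.X (f a b) c d))))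

Z^≋mono : ∀ q → Z ^ᶠ q ≋ mono 0 0 0 q (+ 1)
Z^≋mono zero    = 𝔽.refl
Z^≋mono (suc q) a b c d = ≡.trans (𝔽.*-congˡ {Z} (Z^≋mono q) a b c d)
  (≡.trans (Z⊗ (mono 0 0 0 q (+ 1)) a b c d) (shift a b c d))
  where
  shift : ∀ a b c d → (PS₁.X P₁.* mono 0 0 0 q (+ 1) a b c) d ≡ mono 0 0 0 (suc q) (+ 1) a b c d
  shift zero    zero    zero    zero    = ≡.refl
  shift zero    zero    (suc c) zero    = ≡.refl
  shift zero    (suc b) c       zero    = ≡.refl
  shift (suc a) b       c       zero    = ≡.refl
  shift zero    zero    zero    (suc d) = PS₁.X-*ˢ-suc (mono 0 0 0 q (+ 1) 0 0 0) d
  shift zero    zero    (suc c) (suc d) = PS₁.X-*ˢ-suc (mono 0 0 0 q (+ 1) 0 0 (suc c)) d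
  shift zero    (suc b) c       (suc d) = PS₁.X-*ˢ-suc (mono 0 0 0 q (+ 1) 0 (suc b) c) d
  shift (suc a) b       c       (suc d) = PS₁.X-*ˢ-suc (mono 0 0 0 q (+ 1) (suc a) b c) d

V^≋mono : ∀ l q → V ^ᶠ l ⊗ Z ^ᶠ q ≋ mono 0 0 l q (+ 1)
V^≋mono zero    q = 𝔽.trans (𝔽.*-identityˡ (Z ^ᶠ q)) (Z^≋mono q)
V^≋mono (suc l) q a b c d = ≡.trans (𝔽.*-assoc V (V ^ᶠ l) (Z ^ᶠ q) a b c d)
  (≡.trans (𝔽.*-congˡ {V} (V^≋mono l q) a b c d)
    (≡.trans (V⊗ (mono 0 0 l q (+ 1)) a b c d) (shift a b c)))
  where
  shift : ∀ a b c → (PS₂.X P₂.* mono 0 0 l q (+ 1) a b) c d ≡ mono 0 0 (suc l) q (+ 1) a b c d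
  shift zero    zero    zero    = PS₂.X-*ˢ-zero (mono 0 0 l q (+ 1) 0 0) d
  shift zero    (suc b) zero    = PS₂.X-*ˢ-zero (mono 0 0 l q (+ 1) 0 (suc b)) d
  shift (suc a) b       zero    = PS₂.X-*ˢ-zero (mono 0 0 l q (+ 1) (suc a) b) d
  shift zero    zero    (suc c) = PS₂.X-*ˢ-suc (mono 0 0 l q (+ 1) 0 0) c d
  shift zero    (suc b) (suc c) = PS₂.X-*ˢ-suc (mono 0 0 l q (+ 1) 0 (suc b)) c d
  shift (suc a) b       (suc c) = PS₂.X-*ˢ-suc (mono 0 0 l q (+ 1) (suc a) b) c d

U^≋mono : ∀ e l q → U ^ᶠ e ⊗ (V ^ᶠ l ⊗ Z ^ᶠ q) ≋ mono 0 e l q (+ 1)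
U^≋mono zero    l q = 𝔽.trans (𝔽.*-identityˡ (V ^ᶠ l ⊗ Z ^ᶠ q)) (V^≋mono l q)
U^≋mono (suc e) l q a b c d = ≡.trans (𝔽.*-assoc U (U ^ᶠ e) (V ^ᶠ l ⊗ Z ^ᶠ q) a b c d)
  (≡.trans (𝔽.*-congˡ {U} (U^≋mono e l q) a b c d)
    (≡.trans (U⊗ (mono 0 e l q (+ 1)) a b c d) (shift a b)))
  where
  shift : ∀ a b → (PS₃.X P₃.* mono 0 e l q (+ 1) a) b c d ≡ mono 0 (suc e) l q (+ 1) a b c d
  shift zero    zero    = PS₃.X-*ˢ-zero (mono 0 e l q (+ 1) 0) c d
  shift (suc a) zero    = PS₃.X-*ˢ-zero (mono 0 e l q (+ 1) (suc a)) c d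
  shift zero    (suc b) = PS₃.X-*ˢ-suc (mono 0 e l q (+ 1) 0) b c d
  shift (suc a) (suc b) = PS₃.X-*ˢ-suc (mono 0 e l q (+ 1) (suc a)) b c d

T∈ : tAdic.ord 1 T
T∈ zero b c d _ = ≡.refl
T∈ (suc a) b c d (s≤s ())

U∈ : uAdic.ord 1 U
U∈ zero    zero    c d _ = ≡.refl
U∈ (suc a) zero    c d _ = ≡.refl
U∈ a       (suc b) c d (s≤s ())

T-cancel : ∀ {f g} → T ⊗ f ≋ T ⊗ g → f ≋ g
T-cancel {f} {g} Tf≋Tg a b c d =
  ≡.trans (≡.sym (T⊗-suc f a b c d)) (≡.trans (Tf≋Tg (suc a) b c d) (T⊗-suc g a b c d))

-- Counting ascent sequences

module Σℤ = Sums ℤ.+-*-commutativeRing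
module ℤExt = Extensions ℤ.+-*-commutativeRing
module FExt = Extensions FPS-commutativeRing

module _ {A : Set} where

  count : (A → Bool) → List A → ℕ
  count P xs = length (filterᵇ P xs)

  count-cong : ∀ {P Q : A → Bool} → (∀ x → P x ≡ Q x) → ∀ xs → count P xs ≡ count Q xs
  count-cong P≡Q [] = ≡.refl
  count-cong {P} {Q} P≡Q (x ∷ xs) with P x | Q x | P≡Q x
  ... | true  | true  | _ = ≡.cong suc (count-cong P≡Q xs)
  ... | false | false | _ = count-cong P≡Q xs

  count-false : ∀ {P : A → Bool} → (∀ x → P x ≡ false) → ∀ xs → count P xs ≡ 0
  count-false P≡false [] = ≡.refl
  count-false {P} P≡false (x ∷ xs) with P x | P≡false x
  ... | false | _ = count-false P≡false xs

  count-++ : ∀ (P : A → Bool) xs ys → count P (xs ++ ys) ≡ count P xs ℕ.+ count P ys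
  count-++ P []       ys = ≡.refl
  count-++ P (x ∷ xs) ys with P x
  ... | true  = ≡.cong suc (count-++ P xs ys)
  ... | false = count-++ P xs ys

  count-map : ∀ {B : Set} (P : A → Bool) (f : B → A) xs →
              count P (map f xs) ≡ length (filterᵇ (P ∘ f) xs)
  count-map P f []       = ≡.refl
  count-map P f (x ∷ xs) with P (f x)
  ... | true  = ≡.cong suc (count-map P f xs)
  ... | false = count-map P f xs

count-concatMap : ∀ {A : Set} (P : A → Bool) (g : ℕ → List A) f k →
  + count P (concatMap g (applyUpTo f k)) ≡ Σℤ.Σ< k (λ i → + count P (g (f i)))
count-concatMap P g f zero    = ≡.refl
count-concatMap P g f (suc k) = ≡.trans
  (≡.cong +_ (count-++ P (g (f 0)) _))
  (≡.cong (λ s → + count P (g (f 0)) ℤ.+ s) (count-concatMap P g (f ∘ suc) k))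

count-allLists : ∀ P n k → + count P (allLists (suc n) k) ≡
                 Σℤ.Σ< k (λ x → + count (P ∘ (x ∷_)) (allLists n k))
count-allLists P n k = ≡.trans
  (count-concatMap P (λ x → map (x ∷_) (allLists n k)) id k)
  (Σℤ.Σ<-cong k λ x _ → ≡.cong +_ (count-map P (x ∷_) (allLists n k)))

-- Recognising ascent sequences letter by letter

Statisticᵇ : Set
Statisticᵇ = ℕ → ℕ → ℕ → Bool

indicator : Statisticᵇ → ℤExt.Statistic
indicator χ a l q = if χ a l q then + 1 else + 0

-- Reads the word from the left and carries the state along, whereas `isAscent` recomputes the
-- ascents of every prefix. Its recursion matches that of `extend`.
run : Statisticᵇ → ℕ → ℕ → ℕ → List ℕ → Bool
run χ a l q []      = χ a l q
run χ a l q (x ∷ w) = (x ≤ᵇ suc a) ∧ run χ (ascent l x ℕ.+ a) x (isZero x ℕ.+ q) w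

≤⇒≤ᵇ-true : ∀ {m n} → m ≤ n → (m ≤ᵇ n) ≡ true
≤⇒≤ᵇ-true {m} {n} m≤n = Equivalence.to T-≡ (ℕ.≤⇒≤ᵇ m≤n)

>⇒≤ᵇ-false : ∀ {m n} → n ℕ.< m → (m ≤ᵇ n) ≡ false
>⇒≤ᵇ-false {m} {n} n<m with m ≤ᵇ n in eq
... | false = ≡.refl
... | true  = contradiction (ℕ.≤ᵇ⇒≤ m n (Equivalence.from T-≡ eq)) (ℕ.<⇒≱ n<m)

ascent-≤1 : ∀ l x → ascent l x ≤ 1
ascent-≤1 l x with l <ᵇ x
... | true  = s≤s z≤n
... | false = z≤n

-- The bound keeps every usable entry inside the alphabet: the next one is at most a + 1 < k, and
-- each letter raises `a` by at most one while `m` drops by one. Letters from a + 2 on are rejected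
-- by `run`.
count-run : ∀ χ m k a l q → suc a ℕ.+ m ≤ k →
  + count (run χ a l q) (allLists m k) ≡ ℤExt.extend m (indicator χ) a l q
count-run χ zero k a l q _ with χ a l q
... | true  = ≡.refl
... | false = ≡.refl
count-run χ (suc m) k a l q bound
  with ℕ.m≤n⇒∃[o]m+o≡n (ℕ.≤-trans (ℕ.m≤m+n (suc (suc a)) m)
         (≡.subst (_≤ k) (ℕ.+-suc (suc a) m) bound))
... | j , ≡.refl = begin
  + count (run χ a l q) (allLists (suc m) k)
    ≡⟨ count-allLists (run χ a l q) m k ⟩
  Σℤ.Σ< (suc (suc a) ℕ.+ j) term
    ≡⟨ Σℤ.Σ<-++ (suc (suc a)) j term ⟩
  Σℤ.Σ< (suc (suc a)) term ℤ.+ Σℤ.Σ< j (λ i → term (suc (suc a) ℕ.+ i))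
    ≡⟨ ≡.cong₂ ℤ._+_ (Σℤ.Σ<-cong (suc (suc a)) low) (Σℤ.Σ<-zero j high) ⟩
  ℤExt.extend (suc m) (indicator χ) a l q ℤ.+ + 0
    ≡⟨ ℤ.+-identityʳ _ ⟩
  ℤExt.extend (suc m) (indicator χ) a l q ∎
  where
  open ≡.≡-Reasoning
  term : ℕ → ℤ
  term x = + count (λ w → (x ≤ᵇ suc a) ∧ run χ (ascent l x ℕ.+ a) x (isZero x ℕ.+ q) w)
                   (allLists m k)
  low : ∀ x → x ℕ.< suc (suc a) →
        term x ≡ ℤExt.extend m (indicator χ) (ascent l x ℕ.+ a) x (isZero x ℕ.+ q)
  low x x< rewrite ≤⇒≤ᵇ-true (ℕ.≤-pred x<) =
    count-run χ m k (ascent l x ℕ.+ a) x (isZero x ℕ.+ q) (ℕ.≤-trans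
      (s≤s (ℕ.+-monoˡ-≤ m (ℕ.+-monoˡ-≤ a (ascent-≤1 l x))))
      (≡.subst (_≤ k) (ℕ.+-suc (suc a) m) bound))
  high : ∀ i → i ℕ.< j → term (suc (suc a) ℕ.+ i) ≡ + 0
  high i _ = ≡.cong +_ (count-false
    (λ w → ≡.cong
      (λ b → b ∧ run χ (ascent l (suc (suc a) ℕ.+ i) ℕ.+ a) (suc (suc a) ℕ.+ i) q w)
      (>⇒≤ᵇ-false {suc (suc a) ℕ.+ i} (ℕ.m≤m+n (suc (suc a)) i))) (allLists m k))

asc-snoc : ∀ p l x → asc (p ++ l ∷ x ∷ []) ≡ ascent l x ℕ.+ asc (p ++ [ l ])
asc-snoc []          l x = ≡.refl
asc-snoc (y ∷ [])    l x = begin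
  ascent y l ℕ.+ (ascent l x ℕ.+ 0)  ≡⟨ ≡.cong (ascent y l ℕ.+_) (ℕ.+-identityʳ _) ⟩
  ascent y l ℕ.+ ascent l x          ≡⟨ ℕ.+-comm (ascent y l) _ ⟩
  ascent l x ℕ.+ ascent y l          ≡⟨ ≡.cong (ascent l x ℕ.+_) (ℕ.+-identityʳ _) ⟨
  ascent l x ℕ.+ (ascent y l ℕ.+ 0)  ∎
  where open ≡.≡-Reasoning
asc-snoc (y ∷ y′ ∷ p) l x = ≡.trans
  (≡.cong (ascent y y′ ℕ.+_) (asc-snoc (y′ ∷ p) l x))
  (ℕ+.x∙yz≈y∙xz (ascent y y′) (ascent l x) _)

zeros-snoc : ∀ p x → zeros (p ++ [ x ]) ≡ isZero x ℕ.+ zeros p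
zeros-snoc []      x = ≡.refl
zeros-snoc (y ∷ p) x = ≡.trans (≡.cong (isZero y ℕ.+_) (zeros-snoc p x))
  (ℕ+.x∙yz≈y∙xz (isZero y) (isZero x) _)

last-snoc : ∀ p x → lastℕ (p ++ [ x ]) ≡ x
last-snoc []          x = ≡.refl
last-snoc (y ∷ [])    x = ≡.refl
last-snoc (y ∷ z ∷ p) x = last-snoc (z ∷ p) x

at-next : ∀ (p : List ℕ) l x ys → at (p ++ l ∷ x ∷ ys) (suc (length p)) ≡ x
at-next []      l x ys = ≡.refl
at-next (y ∷ p) l x ys = at-next p l x ys

take-next : ∀ (p : List ℕ) l ys → take (suc (length p)) (p ++ l ∷ ys) ≡ p ++ [ l ]
take-next []      l ys = ≡.refl
take-next (y ∷ p) l ys = ≡.cong (y ∷_) (take-next p l ys)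

bounded : List ℕ → ℕ → Bool
bounded w i = at w i ≤ᵇ suc (asc (take i w))

statistics : Statisticᵇ → List ℕ → Bool
statistics χ w = χ (asc w) (lastℕ w) (zeros w)

-- Induction on the unread part `xs`, with `p` and `l` already read. The word and the position enter
-- through equations so that the recursive call can regroup the word with `l` moved into the prefix.
bounded-run : ∀ χ p l xs w n → w ≡ p ++ l ∷ xs → n ≡ length p →
  allB (bounded w) (range (suc n) (length xs)) ∧ statistics χ w ≡
  run χ (asc (p ++ [ l ])) l (zeros (p ++ [ l ])) xs
bounded-run χ p l [] w n ≡.refl ≡.refl =
  ≡.cong (λ e → χ (asc (p ++ [ l ])) e (zeros (p ++ [ l ]))) (last-snoc p l)
bounded-run χ p l (x ∷ xs) w n ≡.refl ≡.refl = begin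
  (bounded w (suc n) ∧ allB (bounded w) (range (suc (suc n)) (length xs))) ∧ statistics χ w
    ≡⟨ ∧-assoc (bounded w (suc n)) _ _ ⟩
  bounded w (suc n) ∧ (allB (bounded w) (range (suc (suc n)) (length xs)) ∧ statistics χ w)
    ≡⟨ ≡.cong₂ _∧_
         (≡.cong₂ (λ e (s : List ℕ) → e ≤ᵇ suc (asc s))
           (at-next p l x xs) (take-next p l (x ∷ xs)))
         (bounded-run χ (p ++ [ l ]) x xs w (suc n) (≡.sym (++-assoc p [ l ] (x ∷ xs)))
           (≡.sym (≡.trans (length-++ p) (ℕ.+-comm (length p) 1)))) ⟩
  (x ≤ᵇ suc (asc (p ++ [ l ]))) ∧
    run χ (asc ((p ++ [ l ]) ++ [ x ])) x (zeros ((p ++ [ l ]) ++ [ x ])) xs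
    ≡⟨ ≡.cong₂ (λ e s → (x ≤ᵇ suc (asc (p ++ [ l ]))) ∧ run χ e x s xs)
         (≡.trans (≡.cong asc (++-assoc p [ l ] [ x ])) (asc-snoc p l x))
         (zeros-snoc (p ++ [ l ]) x) ⟩
  run χ (asc (p ++ [ l ])) l (zeros (p ++ [ l ])) (x ∷ xs) ∎
  where open ≡.≡-Reasoning

run-zeros : ∀ χ n q w → run χ 0 0 q (replicate n 0 ++ 1 ∷ w) ≡ run χ 1 1 (n ℕ.+ q) w
run-zeros χ zero    q w = ≡.refl
run-zeros χ (suc n) q w = ≡.trans (run-zeros χ n (suc q) w)
  (≡.cong (λ s → run χ 1 1 s w) (ℕ.+-suc n q))

isAscent-run : ∀ χ r w → let w′ = replicate (suc r) 0 ++ 1 ∷ w in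
  isAscent w′ ∧ statistics χ w′ ≡ run χ 1 1 (suc r) w
isAscent-run χ r w = begin
  isAscent w′ ∧ statistics χ w′
    -- The leading 0 is already read: it gives last entry 0 and one zero.
    ≡⟨ bounded-run χ [] 0 (replicate r 0 ++ 1 ∷ w) w′ 0 ≡.refl ≡.refl ⟩
  run χ 0 0 1 (replicate r 0 ++ 1 ∷ w)  ≡⟨ run-zeros χ r 1 w ⟩
  run χ 1 1 (r ℕ.+ 1) w                 ≡⟨ ≡.cong (λ s → run χ 1 1 s w) (ℕ.+-comm r 1) ⟩
  run χ 1 1 (suc r) w                   ∎
  where
  open ≡.≡-Reasoning
  w′ = replicate (suc r) 0 ++ 1 ∷ w

count-∧-false : ∀ (A : List ℕ → Bool) xs → count (λ w → A w ∧ false) xs ≡ 0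
count-∧-false A = count-false (λ w → ∧-zeroʳ (A w))

-- `A` and `B` are arbitrary so that the induction on `r` can absorb the letters of the prefix into
-- them. The alphabet must contain 0 and 1; on a wrong letter `prefixOK` computes to `false`.
count-prefix : ∀ r m k (A B : List ℕ → Bool) → 2 ≤ k →
  count (λ w → A w ∧ (prefixOK r w ∧ B w)) (allLists (suc r ℕ.+ m) k) ≡
  count (λ w → A (replicate r 0 ++ 1 ∷ w) ∧ B (replicate r 0 ++ 1 ∷ w)) (allLists m k)
count-prefix r m (suc (suc j)) A B (s≤s (s≤s z≤n)) = ℤ.+-injective (prefix r A B)
  where
  open ≡.≡-Reasoning
  k = suc (suc j)
  P : ℕ → (List ℕ → Bool) → (List ℕ → Bool) → List ℕ → Bool
  P r A B w = A w ∧ (prefixOK r w ∧ B w)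
  none : ∀ n (x : ℕ) (A : List ℕ → Bool) → + count (λ w → A (x ∷ w) ∧ false) (allLists n k) ≡ + 0
  none n x A = ≡.cong +_ (count-∧-false (A ∘ (x ∷_)) (allLists n k))
  prefix : ∀ r A B → + count (P r A B) (allLists (suc r ℕ.+ m) k) ≡
    + count (λ w → A (replicate r 0 ++ 1 ∷ w) ∧ B (replicate r 0 ++ 1 ∷ w)) (allLists m k)
  prefix zero A B = begin
    + count (P 0 A B) (allLists (suc m) k)
      ≡⟨ count-allLists (P 0 A B) m k ⟩
    + count (P 0 A B ∘ (0 ∷_)) (allLists m k) ℤ.+ (one ℤ.+
      Σℤ.Σ< j (λ x → + count (P 0 A B ∘ (suc (suc x) ∷_)) (allLists m k)))
      ≡⟨ ≡.cong₂ (λ s s′ → s ℤ.+ (one ℤ.+ s′)) (none m 0 A)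
           (Σℤ.Σ<-zero j (λ x _ → none m (suc (suc x)) A)) ⟩
    + 0 ℤ.+ (one ℤ.+ + 0)
      ≡⟨ ≡.trans (ℤ.+-identityˡ _) (ℤ.+-identityʳ one) ⟩
    one ∎
    where one = + count (λ w → A (1 ∷ w) ∧ B (1 ∷ w)) (allLists m k)
  prefix (suc r) A B = begin
    + count (P (suc r) A B) (allLists (suc (suc r) ℕ.+ m) k)
      ≡⟨ count-allLists (P (suc r) A B) (suc r ℕ.+ m) k ⟩
    + count (P r (A ∘ (0 ∷_)) (B ∘ (0 ∷_))) (allLists (suc r ℕ.+ m) k) ℤ.+
      Σℤ.Σ< (suc j) (λ x → + count (P (suc r) A B ∘ (suc x ∷_)) (allLists (suc r ℕ.+ m) k))
      ≡⟨ ≡.cong₂ ℤ._+_ (prefix r (A ∘ (0 ∷_)) (B ∘ (0 ∷_)))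
           (Σℤ.Σ<-zero (suc j) (λ x _ → none (suc r ℕ.+ m) (suc x) A)) ⟩
    extended ℤ.+ + 0
      ≡⟨ ℤ.+-identityʳ extended ⟩
    extended ∎
    where
    extended = + count (λ w → A (replicate (suc r) 0 ++ 1 ∷ w) ∧
                              B (replicate (suc r) 0 ++ 1 ∷ w)) (allLists m k)

count-short : ∀ r n k (A B : List ℕ → Bool) → n ≤ r →
  + count (λ w → A w ∧ (prefixOK r w ∧ B w)) (allLists n k) ≡ + 0
count-short zero    zero    k A B _ rewrite ∧-zeroʳ (A []) = ≡.refl
count-short (suc r) zero    k A B _ rewrite ∧-zeroʳ (A []) = ≡.refl
count-short (suc r) (suc n) k A B (s≤s n≤r) = ≡.trans
  (count-allLists (λ w → A w ∧ (prefixOK (suc r) w ∧ B w)) n k)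
  (Σℤ.Σ<-zero k λ
    { zero    _ → count-short r n k (A ∘ (0 ∷_)) (B ∘ (0 ∷_)) n≤r
    ; (suc x) _ → ≡.cong +_ (count-∧-false (A ∘ (suc x ∷_)) (allLists n k)) })

matches : ℕ → ℕ → ℕ → Statisticᵇ
matches b c d a l q = (a ≡ᵇ b) ∧ ((l ≡ᵇ c) ∧ (q ≡ᵇ d))

G-short : ∀ r n b c d → n ≤ r → G r n b c d ≡ + 0
G-short r n b c d = count-short r n n isAscent (statistics (matches b c d))

-- The prefix has length r + 2 and leaves the state (1, 1, r + 1), so the remaining m letters are
-- counted by `extend` from there.
G-long : ∀ r m b c d → G (suc r) (suc (suc r) ℕ.+ m) b c d ≡
         ℤExt.extend m (indicator (matches b c d)) 1 1 (suc r)
G-long r m b c d = begin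
  G (suc r) k b c d
    ≡⟨ ≡.cong +_ (count-prefix (suc r) m k isAscent (statistics χ) (s≤s (s≤s z≤n))) ⟩
  + count _ (allLists m k)
    ≡⟨ ≡.cong +_ (count-cong (isAscent-run χ r) (allLists m k)) ⟩
  + count (run χ 1 1 (suc r)) (allLists m k)
    ≡⟨ count-run χ m k 1 1 (suc r) (ℕ.+-monoˡ-≤ m (s≤s (s≤s (z≤n {r})))) ⟩
  ℤExt.extend m (indicator χ) 1 1 (suc r) ∎
  where
  open ≡.≡-Reasoning
  k = suc (suc r) ℕ.+ m
  χ = matches b c d

Σ<-coefficient : ∀ n (h : ℕ → FPS) a b c d →
  Σ< n h a b c d ≡ Σℤ.Σ< n (λ i → h i a b c d)
Σ<-coefficient zero    h a b c d = ≡.refl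
Σ<-coefficient (suc n) h a b c d =
  ≡.cong (λ s → h 0 a b c d ℤ.+ s) (Σ<-coefficient n (h ∘ suc) a b c d)

extend-coefficient : ∀ m φ a b c d e l q →
  FExt.extend m φ e l q a b c d ≡ ℤExt.extend m (λ e l q → φ e l q a b c d) e l q
extend-coefficient zero    φ a b c d e l q = ≡.refl
extend-coefficient (suc m) φ a b c d e l q = ≡.trans
  (Σ<-coefficient (suc (suc e)) (FExt.append (FExt.extend m φ) e l q) a b c d)
  (Σℤ.Σ<-cong (suc (suc e)) λ x _ →
    extend-coefficient m φ a b c d (ascent l x ℕ.+ e) x (isZero x ℕ.+ q))

extend-zero : ∀ m e l q → ℤExt.extend m (λ _ _ _ → + 0) e l q ≡ + 0
extend-zero zero    e l q = ≡.refl
extend-zero (suc m) e l q = Σℤ.Σ<-zero (suc (suc e)) λ x _ →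
  extend-zero m (ascent l x ℕ.+ e) x (isZero x ℕ.+ q)

≡ᵇ-sym : ∀ m n → (m ≡ᵇ n) ≡ (n ≡ᵇ m)
≡ᵇ-sym zero    zero    = ≡.refl
≡ᵇ-sym zero    (suc n) = ≡.refl
≡ᵇ-sym (suc m) zero    = ≡.refl
≡ᵇ-sym (suc m) (suc n) = ≡ᵇ-sym m n

monomial-UV : ∀ e l q → FExt.monomial Z U V e l q ≋ mono 0 e l q (+ 1)
monomial-UV e l q =
  𝔽.trans (𝔽.*-assoc (U ^ᶠ e) (V ^ᶠ l) (Z ^ᶠ q)) (U^≋mono e l q)

-- At (u, v) every summand is a pure monomial free of t, so its coefficient is the indicator of the
-- prescribed statistics.
extend-UV-0 : ∀ m b c d r → FExt.extend m (FExt.monomial Z U V) 1 1 r 0 b c d ≡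
              ℤExt.extend m (indicator (matches b c d)) 1 1 r
extend-UV-0 m b c d r = ≡.trans
  (extend-coefficient m (FExt.monomial Z U V) 0 b c d 1 1 r)
  (ℤExt.extend-cong m (λ {e} {l} q _ → ≡.trans (monomial-UV e l q 0 b c d)
    (≡.cong (λ p → if p then + 1 else + 0)
      (≡.cong₂ _∧_ (≡ᵇ-sym b e) (≡.cong₂ _∧_ (≡ᵇ-sym c l) (≡ᵇ-sym d q))))) r (s≤s z≤n))

extend-UV-suc : ∀ m a b c d r →
  FExt.extend m (FExt.monomial Z U V) 1 1 r (suc a) b c d ≡ + 0
extend-UV-suc m a b c d r = ≡.trans
  (extend-coefficient m (FExt.monomial Z U V) (suc a) b c d 1 1 r)
  (≡.trans (ℤExt.extend-cong m (λ {e} {l} q _ → monomial-UV e l q (suc a) b c d) r (s≤s z≤n))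
    (extend-zero m 1 1 r))

T^⊗-+ : ∀ n f a b c d → (T ^ᶠ n ⊗ f) (n ℕ.+ a) b c d ≡ f a b c d
T^⊗-+ zero    f a b c d = 𝔽.*-identityˡ f a b c d
T^⊗-+ (suc n) f a b c d = ≡.trans (𝔽.*-assoc T (T ^ᶠ n) f (suc n ℕ.+ a) b c d)
  (≡.trans (T⊗-suc (T ^ᶠ n ⊗ f) (n ℕ.+ a) b c d) (T^⊗-+ n f a b c d))

sumTo-last : ∀ n {f : ℕ → ℤ} → (∀ i → i ℕ.< n → f i ≡ + 0) → sumTo n f ≡ f n
sumTo-last zero    f≡0 = ≡.refl
sumTo-last (suc n) {f} f≡0 = ≡.trans
  (≡.cong (λ s → s ℤ.+ f (suc n)) (sumTo-zero n (λ i i≤n → f≡0 i (s≤s i≤n))))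
  (ℤ.+-identityˡ _)

-- The generating function as a t-adic sum

module GeneratingFunction (r : ℕ) where

  levels : FPS → FPS → ℕ → FPS
  levels α β m = T ^ᶠ m ⊗ FExt.extend m (FExt.monomial Z α β) 1 1 r

  gf : FPS → FPS → FPS
  gf α β = tAdic.limit (levels α β)

  gf-sum : ∀ α β → tAdic.HasSum (levels α β) (gf α β)
  gf-sum α β = tAdic.limit-sum λ m → tAdic.ord-^-⊗ T∈ m (FExt.extend m (FExt.monomial Z α β) 1 1 r)

  -- Each level is a power of t times a series free of t, so only level m reaches the coefficient of
  -- t^m; the limit stops at level m.
  gf-UV-coefficient : ∀ m b c d →
    gf U V m b c d ≡ ℤExt.extend m (indicator (matches b c d)) 1 1 r
  gf-UV-coefficient m b c d = ≡.trans (sumTo-last m earlier) (≡.trans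
    (≡.trans (≡.cong (λ a → levels U V m a b c d) (≡.sym (ℕ.+-identityʳ m)))
      (T^⊗-+ m (FExt.extend m (FExt.monomial Z U V) 1 1 r) 0 b c d))
    (extend-UV-0 m b c d r))
    where
    earlier : ∀ i → i ℕ.< m → levels U V i m b c d ≡ + 0
    earlier i i<m with ℕ.m≤n⇒∃[o]m+o≡n i<m
    ... | j , ≡.refl = ≡.trans
      (≡.cong (λ a → levels U V i a b c d) (≡.sym (ℕ.+-suc i j)))
      (≡.trans (T^⊗-+ i (FExt.extend i (FExt.monomial Z U V) 1 1 r) (suc j) b c d)
        (extend-UV-suc i j b c d r))

  open KernelMethod.FunctionalEquation FPS-commutativeRing tAdic.filtration
    T (λ {n} y∈ → tAdic.ord-⊗ {1} {n} T∈ y∈) (λ {f} {g} → T-cancel {f} {g}) Z r gf gf-sum public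

-- `gf` records only the appended entries in t; the factor t^(r+2) accounts for the prefix itself.
G≋gf : ∀ r → G (suc r) ≋ T ^ᶠ suc (suc r) ⊗ GeneratingFunction.gf (suc r) U V
G≋gf r a b c d with a ℕ.<? suc (suc r)
... | yes a<r+2 = ≡.trans (G-short (suc r) a b c d (ℕ.≤-pred a<r+2))
  (≡.sym (tAdic.ord-^-⊗ T∈ (suc (suc r)) (gf U V) a b c d a<r+2))
  where open GeneratingFunction (suc r)
... | no  a≮r+2 with ℕ.m≤n⇒∃[o]m+o≡n (ℕ.≮⇒≥ a≮r+2)
...   | m , ≡.refl = ≡.trans (G-long r m b c d) (≡.sym (≡.trans
  (T^⊗-+ (suc (suc r)) (gf U V) m b c d) (gf-UV-coefficient m b c d)))
  where open GeneratingFunction (suc r)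

-- Closed form of the generating function

module _ (R : CommutativeRing 0ℓ 0ℓ) where
  open CommutativeRing R
  open IntegerSolver R
  open SetoidReasoning setoid

  -- The convention `d 0 ≡ 𝟙` agrees with the general formula at k = 0.
  one≈ : ∀ x → 1# ≈ x - 1# * (x - 1#)
  one≈ = solve 1 (λ x → con (+ 1) := x :- con (+ 1) :* (x :- con (+ 1))) refl

  -- The left-hand side is `V ⊗ δ 1 ⊖ 𝟙` as it unfolds, hence the factor `1#` left by the first
  -- power.
  kernel≈ : ∀ t u v → v * (u - (1# - t) * 1# * (u - 1#)) - 1# ≈ v * (1# + t * (u - 1#)) - 1#
  kernel≈ = solve 3 (λ t u v → let o = con (+ 1) in
    v :* (u :- (o :- t) :* o :* (u :- o)) :- o := v :* (o :+ t :* (u :- o)) :- o) refl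

  regroup : ∀ a b c d → a * (b * c * d) ≈ a * b * (c * d)
  regroup = solve 4 (λ a b c d → a :* (b :* c :* d) := a :* b :* (c :* d)) refl

  divide : ∀ {w i g n} → w * i ≈ 1# → w * g ≈ n → g ≈ i * n
  divide {w} {i} {g} {n} wi≈1 wg≈n = begin
    g            ≈⟨ *-identityˡ g ⟨
    1# * g       ≈⟨ *-congʳ wi≈1 ⟨
    w * i * g    ≈⟨ solve 3 (λ w i g → w :* i :* g := i :* (w :* g)) refl w i g ⟩
    i * (w * g)  ≈⟨ *-congˡ wg≈n ⟩
    i * n        ∎

  -- The nested cube of `v` ending in `1#` is the unfolding of `V ^^ 3`.
  factor : ∀ tʳ zʳ t u v z i s s̄ →
    tʳ * (i * (u * v * zʳ * (v - 1#)
      + t * ((z * (v - 1#) - v) * (zʳ * (u * (1# - u)) * s)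
        + u * (v * v) * (zʳ * (u * v * (1# - u * v)) * s̄)))) ≈
    tʳ * zʳ * u * i * (v * (v - 1#) + t * (1# - u) * (z * (v - 1#) - v) * s
      + u * (v * (v * (v * 1#))) * t * (1# - u * v) * s̄)
  factor = solve 9 (λ tʳ zʳ t u v z i s s̄ → let o = con (+ 1) in
    tʳ :* (i :* (u :* v :* zʳ :* (v :- o)
      :+ t :* ((z :* (v :- o) :- v) :* (zʳ :* (u :* (o :- u)) :* s)
        :+ u :* (v :* v) :* (zʳ :* (u :* v :* (o :- u :* v)) :* s̄)))) :=
    tʳ :* zʳ :* u :* i :* (v :* (v :- o) :+ t :* (o :- u) :* (z :* (v :- o) :- v) :* s
      :+ u :* (v :* (v :* (v :* o))) :* t :* (o :- u :* v) :* s̄)) refl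

[1-T]^-constant : ∀ k → ((𝟙 ⊖ T) ^^ k) 0 0 0 0 ≡ + 1
[1-T]^-constant zero    = ≡.refl
[1-T]^-constant (suc k) = ≡.cong (λ x → + 1 ℤ.* x) ([1-T]^-constant k)

-- Treats x = u and x = u v at once. `sumU` supplies only powers of u, so `h-eq` lets the term `h k`
-- carry the remaining part of x^k.
module Specialisation
  (r : ℕ) (x : FPS) (x∈ : uAdic.ord 1 x) (d g h : ℕ → FPS)
  (d-0 : d 0 ≡ 𝟙)
  (d-suc : ∀ k → d (suc k) ≡ x ⊖ ((𝟙 ⊖ T) ^^ suc k) ⊗ (x ⊖ 𝟙))
  (g-suc : ∀ k → g (suc k) ≡ x ⊖ (𝟙 ⊖ Z ⊗ T) ⊗ ((𝟙 ⊖ T) ^^ k) ⊗ (x ⊖ 𝟙))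
  (h-eq : ∀ k → (U ^^ k) ⊗ h k ≋
    x ^ᶠ k ⊗ ((𝟙 ⊖ T) ^ᶠ k ⊗ inv (d k ⊗ d (suc k) ⊗ prod1 (suc k) g)))
  where

  open GeneratingFunction r

  J : ℕ → FPS
  J k = inv (d k ⊗ d (suc k) ⊗ prod1 (suc k) g)

  x₀ : x 0 0 0 0 ≡ + 0
  x₀ = x∈ 0 0 0 0 (s≤s z≤n)

  d-constant : ∀ k → d k 0 0 0 0 ≡ + 1
  d-constant zero rewrite d-0 = ≡.refl
  d-constant (suc k) rewrite d-suc k | x₀ | [1-T]^-constant k = ≡.refl

  g-constant : ∀ k → g (suc k) 0 0 0 0 ≡ + 1
  g-constant k rewrite g-suc k | x₀ | [1-T]^-constant k = ≡.refl

  prod1-constant : ∀ k → prod1 k g 0 0 0 0 ≡ + 1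
  prod1-constant zero    = ≡.refl
  prod1-constant (suc k) rewrite prod1-constant k | g-constant k = ≡.refl

  J-inverse : ∀ k → d k ⊗ d (suc k) ⊗ prod1 (suc k) g ⊗ J k ≋ 𝟙
  J-inverse k = inv-inverse (d k ⊗ d (suc k) ⊗ prod1 (suc k) g) {+ 1}
    (≡.cong₂ ℤ._*_ (≡.cong₂ ℤ._*_ (d-constant k) (d-constant (suc k))) (prod1-constant (suc k)))
    ≡.refl

  d-eq : ∀ k → d k ≋ x ⊖ (𝟙 ⊖ T) ^ᶠ k ⊗ (x ⊖ 𝟙)
  d-eq zero rewrite d-0 = one≈ FPS-commutativeRing x
  d-eq (suc k) rewrite d-suc k | ^^≡^ (𝟙 ⊖ T) k = 𝔽.refl

  g-eq : ∀ k → g (suc k) ≋ x ⊖ (𝟙 ⊖ Z ⊗ T) ⊗ (𝟙 ⊖ T) ^ᶠ k ⊗ (x ⊖ 𝟙)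
  g-eq k rewrite g-suc k | ^^≡^ (𝟙 ⊖ T) k = 𝔽.refl

  module I = Iteration x d g (λ k → prod1 k g) J
    (𝔽.reflexive d-0) d-eq g-eq 𝔽.refl (λ _ → 𝔽.refl) J-inverse

  summand : ℕ → FPS
  summand k = I.c ⊗ (x ^ᶠ k ⊗ ((𝟙 ⊖ T) ^ᶠ k ⊗ J k))

  -- The remainder of `gf-truncated` has order at least n in u, so `gf x 𝟙` is the u-adic sum of
  -- `summand`; `I.c ⊗ sumU h` is the sum of the same terms.
  gf-closed : gf x 𝟙 ≋ I.c ⊗ sumU h
  gf-closed = uAdic.HasSum-unique {summand}
    (λ n → Filtration.ord-cong uAdic.filtration {n} (remainder n)
      (uAdic.ord-^-⊗ x∈ n (I.p n ⊗ I.E n)))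
    (uAdic.HasSum-* I.c {λ k → x ^ᶠ k ⊗ ((𝟙 ⊖ T) ^ᶠ k ⊗ J k)} {sumU h}
      (uAdic.HasSum-cong {λ k → (U ^^ k) ⊗ h k} {_} {sumU h} h-eq
        (uAdic.limit-sum λ k → ≡.subst (λ f → uAdic.ord k (f ⊗ h k)) (≡.sym (^^≡^ U k))
          (uAdic.ord-^-⊗ U∈ k (h k)))))
    where
    remainder : ∀ n → x ^ᶠ n ⊗ (I.p n ⊗ I.E n) ≋ gf x 𝟙 ⊖ Σ< n summand
    remainder n = 𝔽.sym (𝔽.trans (𝔽.+-congʳ {⊝ (Σ< n summand)} (I.gf-truncated n))
      (xyx⁻¹≈y (Σ< n summand) (x ^ᶠ n ⊗ (I.p n ⊗ I.E n))))
      where open import Algebra.Properties.AbelianGroup 𝔽.+-abelianGroup using (xyx⁻¹≈y)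

module UnbarredSum (r : ℕ) = Specialisation r U U∈ δ γ
  (λ s → ((𝟙 ⊖ T) ^^ s) ⊗ inv (δ s ⊗ δ (suc s) ⊗ prod1 (suc s) γ))
  ≡.refl (λ _ → ≡.refl) (λ _ → ≡.refl)
  (λ s → 𝔽.*-cong {U ^^ s} {U ^ᶠ s} (𝔽.reflexive (^^≡^ U s))
    (𝔽.*-congʳ {inv (δ s ⊗ δ (suc s) ⊗ prod1 (suc s) γ)} (𝔽.reflexive (^^≡^ (𝟙 ⊖ T) s))))

UV∈ : uAdic.ord 1 (U ⊗ V)
UV∈ = uAdic.ord-⊗ {1} {0} {U} {V} U∈ (λ _ _ _ _ ())

barred-summand : ∀ s j → (U ^^ s) ⊗ ((V ^^ s) ⊗ ((𝟙 ⊖ T) ^^ s) ⊗ j) ≋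
                 (U ⊗ V) ^ᶠ s ⊗ ((𝟙 ⊖ T) ^ᶠ s ⊗ j)
barred-summand s j rewrite ^^≡^ U s | ^^≡^ V s | ^^≡^ (𝟙 ⊖ T) s = begin
  U ^ᶠ s ⊗ (V ^ᶠ s ⊗ w ⊗ j)    ≈⟨ regroup FPS-commutativeRing (U ^ᶠ s) (V ^ᶠ s) w j ⟩
  (U ^ᶠ s ⊗ V ^ᶠ s) ⊗ (w ⊗ j)  ≈⟨ 𝔽.*-congʳ {w ⊗ j} (^-distrib-* U V s) ⟨
  (U ⊗ V) ^ᶠ s ⊗ (w ⊗ j)       ∎
  where
  open SetoidReasoning 𝔽.setoid
  w = (𝟙 ⊖ T) ^ᶠ s

module BarredSum (r : ℕ) = Specialisation r (U ⊗ V) UV∈ δ̄ γ̄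
  (λ s → (V ^^ s) ⊗ ((𝟙 ⊖ T) ^^ s) ⊗ inv (δ̄ s ⊗ δ̄ (suc s) ⊗ prod1 (suc s) γ̄))
  ≡.refl (λ _ → ≡.refl) (λ _ → ≡.refl)
  (λ s → barred-summand s (inv (δ̄ s ⊗ δ̄ (suc s) ⊗ prod1 (suc s) γ̄)))

theorem3 : (r : ℕ) → 1 ≤ r →
    G r ≋ (T ^^ suc r) ⊗ (Z ^^ r) ⊗ U ⊗ inv (V ⊗ δ 1 ⊖ 𝟙)
    ⊗ ( V ⊗ (V ⊖ 𝟙)
    ⊕ T ⊗ (𝟙 ⊖ U) ⊗ (Z ⊗ (V ⊖ 𝟙) ⊖ V)
    ⊗ sumU (λ s → ((𝟙 ⊖ T) ^^ s)
    ⊗ inv (δ s ⊗ δ (suc s) ⊗ prod1 (suc s) γ))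
    ⊕ U ⊗ (V ^^ 3) ⊗ T ⊗ (𝟙 ⊖ U ⊗ V)
    ⊗ sumU (λ s → (V ^^ s) ⊗ ((𝟙 ⊖ T) ^^ s)
    ⊗ inv (δ̄ s ⊗ δ̄ (suc s) ⊗ prod1 (suc s) γ̄)) )
theorem3 (suc r) (s≤s z≤n) = begin
  G (suc r)
    ≈⟨ G≋gf r ⟩
  tʳ ⊗ gf U V
    -- The kernel at (u, v) has constant term -1, whose square is 1; both facts hold by computation,
    -- so the kernel can be inverted.
    ≈⟨ 𝔽.*-congˡ {tʳ} {gf U V} {i ⊗ N} (divide FPS-commutativeRing
         {V ⊗ δ 1 ⊖ 𝟙} {i} {gf U V} {N} (inv-inverse (V ⊗ δ 1 ⊖ 𝟙) ≡.refl ≡.refl)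
         (𝔽.trans (𝔽.*-congʳ {gf U V} (kernel≈ FPS-commutativeRing T U V)) (gf-kernel U V))) ⟩
  tʳ ⊗ (i ⊗ N)
    -- The two unknown values left on the right are those at (u, 1) and (u v, 1), which the
    -- iteration has summed.
    ≈⟨ 𝔽.*-congˡ {tʳ} (𝔽.*-congˡ {i} (𝔽.+-congˡ {U ⊗ V ⊗ zʳ ⊗ (V ⊖ 𝟙)} (𝔽.*-congˡ {T} (𝔽.+-cong
         (𝔽.*-congˡ {Z ⊗ (V ⊖ 𝟙) ⊖ V} (UnbarredSum.gf-closed (suc r)))
         (𝔽.*-congˡ {U ⊗ (V ⊗ V)} (BarredSum.gf-closed (suc r))))))) ⟩
  tʳ ⊗ (i ⊗ (U ⊗ V ⊗ zʳ ⊗ (V ⊖ 𝟙)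
    ⊕ T ⊗ ((Z ⊗ (V ⊖ 𝟙) ⊖ V) ⊗ (zʳ ⊗ (U ⊗ (𝟙 ⊖ U)) ⊗ S)
      ⊕ U ⊗ (V ⊗ V) ⊗ (zʳ ⊗ (U ⊗ V ⊗ (𝟙 ⊖ U ⊗ V)) ⊗ S̄))))
    ≈⟨ factor FPS-commutativeRing tʳ zʳ T U V Z i S S̄ ⟩
  tʳ ⊗ zʳ ⊗ U ⊗ i ⊗ B
    ≡⟨ ≡.cong₂ (λ t z → t ⊗ z ⊗ U ⊗ i ⊗ B) (^^≡^ T (suc (suc r))) (^^≡^ Z (suc r)) ⟨
  (T ^^ suc (suc r)) ⊗ (Z ^^ suc r) ⊗ U ⊗ i ⊗ B ∎
  where
  open SetoidReasoning 𝔽.setoid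
  open GeneratingFunction (suc r)
  tʳ = T ^ᶠ suc (suc r)
  zʳ = Z ^ᶠ suc r
  i = inv (V ⊗ δ 1 ⊖ 𝟙)
  S = sumU (λ s → ((𝟙 ⊖ T) ^^ s) ⊗ inv (δ s ⊗ δ (suc s) ⊗ prod1 (suc s) γ))
  S̄ = sumU (λ s → (V ^^ s) ⊗ ((𝟙 ⊖ T) ^^ s) ⊗ inv (δ̄ s ⊗ δ̄ (suc s) ⊗ prod1 (suc s) γ̄))
  N = U ⊗ V ⊗ zʳ ⊗ (V ⊖ 𝟙)
    ⊕ T ⊗ ((Z ⊗ (V ⊖ 𝟙) ⊖ V) ⊗ gf U 𝟙 ⊕ U ⊗ (V ⊗ V) ⊗ gf (U ⊗ V) 𝟙)
  B = V ⊗ (V ⊖ 𝟙) ⊕ T ⊗ (𝟙 ⊖ U) ⊗ (Z ⊗ (V ⊖ 𝟙) ⊖ V) ⊗ S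
    ⊕ U ⊗ (V ^^ 3) ⊗ T ⊗ (𝟙 ⊖ U ⊗ V) ⊗ S̄
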